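{- Let $G$ be a connected graph. Then the following hold, where in each item every graph whose invariant $\kappa_3$ or $\lambda_3$ appears is assumed to have at least $3$ vertices: (1) $\lambda_3(G)\leq \kappa_3(L(G))$. (2) $\lambda_3(L(G))\geq \frac{3}{2}\lambda_3(G)-2$. (3) $\kappa_3(L(L(G)))\geq \frac{3}{2}\kappa_3(G)-2$.
   Context: All graphs are undirected, finite and simple. $L(G)$ denotes the line graph of $G$. For a graph $G$ and a set $S\subseteq V(G)$ of at least two vertices, a tree connecting $S$ is a subgraph $T$ of $G$ that is a tree with $S\subseteq V(T)$. Two trees $T,T'$ connecting $S$ are internally disjoint if $E(T)\cap E(T')=\varnothing$ and $V(T)\cap V(T')=S$. Let $\kappa(S)$ be the maximum number of pairwise internally disjoint trees connecting $S$ in $G$, and $\lambda(S)$ the maximum number of pairwise edge-disjoint trees connecting $S$ in $G$. Then $\kappa_3(G)=\min\{\kappa(S) : S\subseteq V(G),\ |S|=3\}$ and $\lambda_3(G)=\min\{\lambda(S) : S\subseteq V(G),\ |S|=3\}$. -}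

module Defs where

import Data.Empty as Empty
open Empty using (⊥-elim)
open import Data.Fin as Fin using (Fin; zero; suc)
open import Data.Fin.Properties as Fin using (any?; all?; injective⇒≤)
open import Data.Fin.Subset using (Subset; _∈_; _⊆_; _∩_; ∣_∣; Empty; ⊥; inside; outside)
open import Data.Fin.Subset.Properties using (_∈?_; _⊆?_; nonempty?; anySubset?; x∈p∩q⁺; ∣⊥∣≡0)
open import Data.List as List using (List; []; _∷_; _∷ʳ_; length; lookup; filter; allFin; cartesianProduct)
open import Data.List.Membership.Propositional using () renaming (_∈_ to _∈ₗ_)
open import Data.List.Membership.Propositional.Properties using (∈-allFin; ∈-lookup)
open import Data.List.Relation.Unary.All as All using (All; []; _∷_)
open import Data.List.Relation.Unary.AllPairs using ([]; _∷_)
open import Data.List.Relation.Unary.Any using (here; there)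
open import Data.List.Relation.Unary.Linked using (Linked; linked?)
open import Data.List.Relation.Unary.Unique.Propositional using (Unique)
import Data.List.Relation.Unary.Unique.DecPropositional as DecUnique
open import Data.Nat using (ℕ; zero; suc; _≤_; z≤n; s≤s; s≤s⁻¹; _≤?_)
import Data.Nat as ℕ
open import Data.Nat.Properties
  using (≤-trans; ≤-reflexive; ≤-antisym; ≤∧≢⇒<; +-identityʳ; +-suc; ≡-irrelevant)
open import Data.Product using (Σ; ∃; ∃-syntax; _×_; _,_; proj₁; proj₂)
open import Data.Product.Properties using (≡-dec)
open import Data.Sum using (_⊎_; inj₁; inj₂; [_,_]′)
open import Data.Vec as Vec using (Vec; []; _∷_)
open import Data.Vec.Properties using (lookup∘tabulate) renaming (≡-dec to Vec-≡-dec)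
import Data.Bool.Properties as Bool
open import Function using (_∘_; Injective)
open import Level using (0ℓ)
open import Relation.Binary using (Rel; Decidable; Symmetric; Irreflexive)
open import Relation.Binary.Construct.Closure.ReflexiveTransitive using (Star; ε; _◅_; _◅◅_)
open import Relation.Binary.PropositionalEquality using (_≡_; _≢_; refl; sym; trans; cong; subst; subst₂)
open import Relation.Nullary using (Dec; yes; no; ¬_)
open import Relation.Nullary.Decidable using (map′; ¬?; recompute; _×-dec_; _⊎-dec_; _→-dec_)
import Relation.Unary as U

record Graph (n : ℕ) : Set₁ where
  infix 4 _~_ _~?_
  field
    _~_      : Rel (Fin n) 0ℓ
    _~?_     : Decidable _~_
    ~-sym    : Symmetric _~_
    ~-irrefl : Irreflexive _≡_ _~_

module _ {n : ℕ} where

  Connected : Graph n → Set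
  Connected G = ∀ u v → Star (Graph._~_ G) u v

  Cycle : Rel (Fin n) 0ℓ → List (Fin n) → Set
  Cycle R []       = Empty.⊥
  Cycle R (x ∷ xs) = 3 ≤ length (x ∷ xs) × Unique (x ∷ xs) × Linked R (x ∷ xs ∷ʳ x)

  Acyclic : Rel (Fin n) 0ℓ → Set
  Acyclic R = ¬ ∃ (Cycle R)

module _ {n : ℕ} (G : Graph n) where
  open Graph G

  -- Each edge is listed once, as the pair (u , v) of its ends with u < v.
  edgeList : List (Fin n × Fin n)
  edgeList = filter (λ (u , v) → (u Fin.<? v) ×-dec (u ~? v))
                    (cartesianProduct (allFin n) (allFin n))

  size : ℕ
  size = length edgeList

  Edge : Set
  Edge = Fin size

  ends : Edge → Fin n × Fin n
  ends = lookup edgeList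

  Incident : Fin n → Edge → Set
  Incident v e = v ≡ proj₁ (ends e) ⊎ v ≡ proj₂ (ends e)

  incident? : Decidable Incident
  incident? v e = (v Fin.≟ proj₁ (ends e)) ⊎-dec (v Fin.≟ proj₂ (ends e))

  L : Graph size
  L = record
    { _~_      = λ e f → e ≢ f × ∃[ v ] Incident v e × Incident v f
    ; _~?_     = λ e f → ¬? (e Fin.≟ f) ×-dec any? (λ v → incident? v e ×-dec incident? v f)
    ; ~-sym    = λ (e≢f , v , p , q) → e≢f ∘ sym , v , q , p
    ; ~-irrefl = λ e≡f (e≢f , _) → e≢f e≡f
    }

  Closed : Subset n → Subset size → Set
  Closed vs es = ∀ e → e ∈ es → ∀ v → Incident v e → v ∈ vs

  record Subgraph : Set where
    constructor mkSubgraph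
    field
      V       : Subset n
      E       : Subset size
      .closed : Closed V E

  open Subgraph

  Adj : Subgraph → Rel (Fin n) 0ℓ
  Adj T u v = ∃[ e ] e ∈ E T × (ends e ≡ (u , v) ⊎ ends e ≡ (v , u))

  IsTree : Subgraph → Set
  IsTree T = (∀ u v → u ∈ V T → v ∈ V T → Star (Adj T) u v) × Acyclic (Adj T)

  TreeConnecting : Subset n → Subgraph → Set
  TreeConnecting S T = IsTree T × S ⊆ V T

  EdgeDisjoint : Rel Subgraph 0ℓ
  EdgeDisjoint T T′ = Empty (E T ∩ E T′)

  InternallyDisjoint : Subset n → Rel Subgraph 0ℓ
  InternallyDisjoint S T T′ = EdgeDisjoint T T′ × V T ∩ V T′ ≡ S

  -- Indexed families suffice: for |S| ≥ 2 a tree connecting S has an edge, so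
  -- edge-disjoint members are distinct.
  Packing : Subset n → Rel Subgraph 0ℓ → ℕ → Set
  Packing S D k = Σ (Fin k → Subgraph) λ T →
    (∀ i → TreeConnecting S (T i)) × (∀ i j → i ≢ j → D (T i) (T j))

IsMaximum : (ℕ → Set) → ℕ → Set
IsMaximum P m = P m × (∀ k → P k → k ≤ m)

IsMinimum : (ℕ → Set) → ℕ → Set
IsMinimum P m = P m × (∀ k → P k → m ≤ k)

maximum : {P : ℕ → Set} → U.Decidable P → P 0 → ∀ b → (∀ k → P k → k ≤ b) → ∃ (IsMaximum P)
maximum P? p₀ zero    bd = 0 , p₀ , bd
maximum P? p₀ (suc b) bd with P? (suc b)
... | yes p = suc b , p , bd
... | no ¬p = maximum P? p₀ b λ k p → s≤s⁻¹ (≤∧≢⇒< (bd k p) λ { refl → ¬p p })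

minimum : {P : ℕ → Set} → U.Decidable P → ∀ b → P b → ∃ (IsMinimum P)
minimum {P} P? b p = go b 0 (λ _ _ → z≤n) (≤-reflexive (sym (+-identityʳ b)))
  where
  go : ∀ f m → (∀ k → P k → m ≤ k) → b ℕ.≤ f ℕ.+ m → ∃ (IsMinimum P)
  go f m lb b≤ with P? m
  ... | yes q = m , q , lb
  go zero    m lb b≤ | no ¬q = ⊥-elim (¬q (subst P (≤-antisym b≤ (lb b p)) p))
  go (suc f) m lb b≤ | no ¬q =
    go f (suc m) (λ k q → ≤∧≢⇒< (lb k q) λ { refl → ¬q q })
       (≤-trans b≤ (≤-reflexive (sym (+-suc f m))))

module _ {n : ℕ} {R : Rel (Fin n) 0ℓ} (R? : Decidable R) where

  private
    -- Warshall: walks whose interior vertices all lie in the given list.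
    Via : List (Fin n) → Rel (Fin n) 0ℓ
    Via []       u v = u ≡ v ⊎ R u v
    Via (k ∷ ks) u v = Via ks u v ⊎ (Via ks u k × Via ks k v)

    via? : ∀ ks → Decidable (Via ks)
    via? []       u v = (u Fin.≟ v) ⊎-dec R? u v
    via? (k ∷ ks) u v = via? ks u v ⊎-dec (via? ks u k ×-dec via? ks k v)

    via⇒star : ∀ ks {u v} → Via ks u v → Star R u v
    via⇒star []       (inj₁ refl)    = ε
    via⇒star []       (inj₂ r)       = r ◅ ε
    via⇒star (k ∷ ks) (inj₁ p)       = via⇒star ks p
    via⇒star (k ∷ ks) (inj₂ (p , q)) = via⇒star ks p ◅◅ via⇒star ks q

    via-base : ∀ ks {u v} → Via [] u v → Via ks u v
    via-base []       p = p
    via-base (k ∷ ks) p = inj₁ (via-base ks p)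

    via-trans : ∀ ks {u w v} → w ∈ₗ ks → Via ks u w → Via ks w v → Via ks u v
    via-trans (k ∷ ks) (here refl) p q = inj₂ ([ (λ x → x) , proj₁ ]′ p , [ (λ x → x) , proj₂ ]′ q)
    via-trans (k ∷ ks) (there w∈)  (inj₁ p)        (inj₁ q)        = inj₁ (via-trans ks w∈ p q)
    via-trans (k ∷ ks) (there w∈)  (inj₁ p)        (inj₂ (q , q′)) = inj₂ (via-trans ks w∈ p q , q′)
    via-trans (k ∷ ks) (there w∈)  (inj₂ (p , p′)) (inj₁ q)        = inj₂ (p , via-trans ks w∈ p′ q)
    via-trans (k ∷ ks) (there w∈)  (inj₂ (p , _))  (inj₂ (_ , q′)) = inj₂ (p , q′)

    star⇒via : ∀ {u v} → Star R u v → Via (allFin n) u v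
    star⇒via ε        = via-base (allFin n) (inj₁ refl)
    star⇒via (r ◅ rs) = via-trans (allFin n) (∈-allFin _) (via-base (allFin n) (inj₂ r)) (star⇒via rs)

    unique-length : {xs : List (Fin n)} → Unique xs → length xs ≤ n
    unique-length {xs} u = injective⇒≤ (inj u)
      where
      inj : ∀ {xs} → Unique xs → Injective _≡_ _≡_ (lookup xs)
      inj (_ ∷ _)  {zero}  {zero}  _  = refl
      inj (x ∷ _)  {zero}  {suc j} eq = ⊥-elim (All.lookup x (∈-lookup j) eq)
      inj (x ∷ _)  {suc i} {zero}  eq = ⊥-elim (All.lookup x (∈-lookup i) (sym eq))
      inj (_ ∷ us) {suc i} {suc j} eq = cong suc (inj us eq)

    anyList? : ∀ b {P : List (Fin n) → Set} → U.Decidable P → Dec (∃[ xs ] length xs ≤ b × P xs)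
    anyList? zero    P? = map′ (λ p → [] , z≤n , p) (λ { ([] , _ , p) → p }) (P? [])
    anyList? (suc b) P? =
      map′ [ (λ p → [] , z≤n , p) , (λ (x , xs , l , p) → x ∷ xs , s≤s l , p) ]′
           (λ { ([] , _ , p) → inj₁ p ; (x ∷ xs , s≤s l , p) → inj₂ (x , xs , l , p) })
           (P? [] ⊎-dec any? λ x → anyList? b (λ xs → P? (x ∷ xs)))

    cycle? : U.Decidable (Cycle R)
    cycle? []       = no λ ()
    cycle? (x ∷ xs) = (3 ≤? length (x ∷ xs))
                      ×-dec DecUnique.unique? Fin._≟_ (x ∷ xs)
                      ×-dec linked? R? (x ∷ xs ∷ʳ x)

    cycle-length : ∀ xs → Cycle R xs → length xs ≤ n
    cycle-length (_ ∷ _) (_ , u , _) = unique-length u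

  star? : Decidable (Star R)
  star? u v = map′ (via⇒star (allFin n)) star⇒via (via? (allFin n) u v)

  acyclic? : Dec (Acyclic R)
  acyclic? = ¬? (map′ (λ (xs , _ , c) → xs , c) (λ (xs , c) → xs , cycle-length xs c , c)
                      (anyList? n cycle?))

module _ {n : ℕ} (G : Graph n) where
  open Subgraph

  closed? : ∀ vs es → Dec (Closed G vs es)
  closed? vs es = all? λ e → (e ∈? es) →-dec all? λ v → incident? G v e →-dec (v ∈? vs)

  ends-in-V : (T : Subgraph G) → Closed G (V T) (E T)
  ends-in-V (mkSubgraph vs es c) = recompute (closed? vs es) c

  adj? : (T : Subgraph G) → Decidable (Adj G T)
  adj? T u v = any? λ e → (e ∈? E T) ×-dec (ends G e ≟ (u , v) ⊎-dec ends G e ≟ (v , u))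
    where _≟_ = ≡-dec Fin._≟_ Fin._≟_

  treeConnecting? : ∀ S → U.Decidable (TreeConnecting G S)
  treeConnecting? S T =
    ((all? λ u → all? λ v → (u ∈? V T) →-dec ((v ∈? V T) →-dec star? (adj? T) u v))
      ×-dec acyclic? (adj? T))
    ×-dec (S ⊆? V T)

  edgeDisjoint? : Decidable (EdgeDisjoint G)
  edgeDisjoint? T T′ = ¬? (nonempty? (E T ∩ E T′))

  internallyDisjoint? : ∀ S → Decidable (InternallyDisjoint G S)
  internallyDisjoint? S T T′ = edgeDisjoint? T T′ ×-dec Vec-≡-dec Bool._≟_ (V T ∩ V T′) S

  private
    anySubgraph? : {P : Subgraph G → Set} → U.Decidable P → Dec (∃ P)
    anySubgraph? {P} P? =
      map′ (λ (vs , es , c , p) → mkSubgraph vs es c , p)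
           (λ (T , p) → V T , E T , ends-in-V T , p)
           (anySubset? λ vs → anySubset? λ es → with-closed vs es)
      where
      with-closed : ∀ vs es → Dec (Σ (Closed G vs es) λ c → P (mkSubgraph vs es c))
      with-closed vs es with closed? vs es
      ... | no ¬c = no (¬c ∘ proj₁)
      ... | yes c = map′ (c ,_) proj₂ (P? (mkSubgraph vs es c))

    anyVec? : ∀ k {P : Vec (Subgraph G) k → Set} → U.Decidable P → Dec (∃ P)
    anyVec? zero    P? = map′ ([] ,_) (λ { ([] , p) → p }) (P? [])
    anyVec? (suc k) P? =
      map′ (λ (T , Ts , p) → T ∷ Ts , p) (λ { (T ∷ Ts , p) → T , Ts , p })
           (anySubgraph? λ T → anyVec? k λ Ts → P? (T ∷ Ts))

  packing? : ∀ S {D} → Decidable D → U.Decidable (Packing G S D)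
  packing? S {D} D? k =
    map′ (λ (Ts , p) → Vec.lookup Ts , p)
         (λ (T , t , d) → Vec.tabulate T
            , (λ i → subst (TreeConnecting G S) (sym (lookup∘tabulate T i)) (t i))
            , (λ i j i≢j → subst₂ D (sym (lookup∘tabulate T i)) (sym (lookup∘tabulate T j)) (d i j i≢j)))
         (anyVec? k λ Ts →
           (all? λ i → treeConnecting? S (Vec.lookup Ts i))
           ×-dec (all? λ i → all? λ j → ¬? (i Fin.≟ j) →-dec D? (Vec.lookup Ts i) (Vec.lookup Ts j)))

private
  nonempty : ∀ {n} {S : Subset n} → 1 ≤ ∣ S ∣ → ∃[ u ] u ∈ S
  nonempty {S = inside  ∷ S} _ = zero , Vec.here
  nonempty {S = outside ∷ S} p = let u , u∈ = nonempty p in suc u , Vec.there u∈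

  two-elements : ∀ {n} {S : Subset n} → 2 ≤ ∣ S ∣ → ∃[ u ] ∃[ v ] u ∈ S × v ∈ S × u ≢ v
  two-elements {S = inside  ∷ S} (s≤s p) =
    let v , v∈ = nonempty p in zero , suc v , Vec.here , Vec.there v∈ , λ ()
  two-elements {S = outside ∷ S} p =
    let u , v , u∈ , v∈ , u≢v = two-elements p
    in suc u , suc v , Vec.there u∈ , Vec.there v∈ , u≢v ∘ Fin.suc-injective

module _ {n : ℕ} (G : Graph n) {S : Subset n} (2≤∣S∣ : 2 ≤ ∣ S ∣) where
  open Subgraph

  private
    tree-edge : ∀ T → TreeConnecting G S T → ∃[ e ] e ∈ E T
    tree-edge T ((conn , _) , S⊆) with two-elements 2≤∣S∣
    ... | u , v , u∈ , v∈ , u≢v with conn u v (S⊆ u∈) (S⊆ v∈)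
    ...   | ε               = ⊥-elim (u≢v refl)
    ...   | (e , e∈ , _) ◅ _ = e , e∈

  packing-bound : ∀ {D} → (∀ {T T′} → D T T′ → EdgeDisjoint G T T′) →
                  ∀ k → Packing G S D k → k ≤ size G
  packing-bound D⇒ k (T , t , d) = injective⇒≤ {f = f} inj
    where
    f : Fin k → Fin (size G)
    f i = proj₁ (tree-edge (T i) (t i))
    inj : Injective _≡_ _≡_ f
    inj {i} {j} eq with i Fin.≟ j
    ... | yes i≡j = i≡j
    ... | no  i≢j = ⊥-elim (D⇒ (d i j i≢j) (f i , x∈p∩q⁺
          (proj₂ (tree-edge (T i) (t i)) , subst (_∈ E (T j)) (sym eq) (proj₂ (tree-edge (T j) (t j))))))

-- These extrema are abstract so that only their specifications are available:
-- the values never reduce.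
module _ {n : ℕ} (G : Graph n) where

  abstract
    κ-exists : ∀ S → 2 ≤ ∣ S ∣ → ∃ (IsMaximum (Packing G S (InternallyDisjoint G S)))
    κ-exists S 2≤ = maximum (packing? G S (internallyDisjoint? G S))
      ((λ ()) , (λ ()) , λ ()) (size G) (packing-bound G 2≤ {D = InternallyDisjoint G S} proj₁)

    λ-exists : ∀ S → 2 ≤ ∣ S ∣ → ∃ (IsMaximum (Packing G S (EdgeDisjoint G)))
    λ-exists S 2≤ = maximum (packing? G S (edgeDisjoint? G))
      ((λ ()) , (λ ()) , λ ()) (size G) (packing-bound G 2≤ {D = EdgeDisjoint G} λ d → d)

  κ-of : ∀ S → 2 ≤ ∣ S ∣ → ℕ
  κ-of S 2≤ = proj₁ (κ-exists S 2≤)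

  λ-of : ∀ S → 2 ≤ ∣ S ∣ → ℕ
  λ-of S 2≤ = proj₁ (λ-exists S 2≤)

3⇒2≤ : ∀ {m} → m ≡ 3 → 2 ≤ m
3⇒2≤ refl = s≤s (s≤s z≤n)

ValueAt₃ : ∀ {n} → ((S : Subset n) → 2 ≤ ∣ S ∣ → ℕ) → ℕ → Set
ValueAt₃ {n} f m = Σ (Subset n) λ S → Σ (∣ S ∣ ≡ 3) λ ∣S∣≡3 → f S (3⇒2≤ ∣S∣≡3) ≡ m

private
  subset-of-size : ∀ {k n} → k ≤ n → ∃[ S ] ∣_∣ {n} S ≡ k
  subset-of-size {n = n} z≤n = ⊥ , ∣⊥∣≡0 n
  subset-of-size (s≤s p) = let S , eq = subset-of-size p in inside ∷ S , cong suc eq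

abstract
  minimum₃ : ∀ {n} → 3 ≤ n → (f : (S : Subset n) → 2 ≤ ∣ S ∣ → ℕ) → ∃ (IsMinimum (ValueAt₃ f))
  minimum₃ 3≤n f = let S , ∣S∣≡3 = subset-of-size 3≤n in minimum value? _ (S , ∣S∣≡3 , refl)
    where
    at : ∀ S m → Dec (Σ (∣ S ∣ ≡ 3) λ ∣S∣≡3 → f S (3⇒2≤ ∣S∣≡3) ≡ m)
    at S m with ∣ S ∣ ℕ.≟ 3
    ... | no ≢3  = no (≢3 ∘ proj₁)
    ... | yes ≡3 = map′ (≡3 ,_)
      (λ (≡3′ , eq) → trans (cong (f S ∘ 3⇒2≤) (≡-irrelevant ≡3 ≡3′)) eq)
      (f S (3⇒2≤ ≡3) ℕ.≟ m)

    value? : U.Decidable (ValueAt₃ f)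
    value? m = anySubset? λ S → at S m

module _ {n : ℕ} (G : Graph n) (3≤n : 3 ≤ n) where

  κ₃ : ℕ
  κ₃ = proj₁ (minimum₃ 3≤n (κ-of G))

  λ₃ : ℕ
  λ₃ = proj₁ (minimum₃ 3≤n (λ-of G))

{-# OPTIONS --safe #-}
-- Let e₀, e₁, e₂ be edges of G, choose distinct ends v₀, v₁, v₂ of them, and let T be a family of k
-- edge-disjoint trees through v₀, v₁, v₂. The edges of G at a vertex x form a clique of L(G), and
-- every edge of L(G) lies in exactly one of these cliques. In the clique at v_l, the edges of L(G)
-- at e_l attach e_l to the trees. The remaining edges of G at x are listed tree by tree. A complete
-- graph on d vertices contains ⌊d/2⌋ edge-disjoint connected spanning graphs, the first of which can
-- be taken to be the path that follows this list. That path keeps each tree connected, whence k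
-- internally disjoint trees in L(G), which is (1). Every further spanning graph, taken in all cliques at once,
-- gives a "layer" that connects e₀, e₁, e₂, since G stays connected without these three edges if
-- λ₃(G) ≥ 4. As all degrees are at least λ₃(G), there is room for ⌈λ₃(G)/2⌉ - 2 layers.
-- Item (3) follows from κ₃(G) ≤ λ₃(G), item (2), and item (1) for L(G).
module Submission where

open import Defs
open import Data.Nat using (ℕ; _≤_)
open import Data.Integer using (+_)
open import Data.Product using (_×_)
open import Data.Rational as ℚ using (_/_; _*_; _-_)

open import Data.Bool using (Bool; false; not; if_then_else_)
open import Data.Fin as Fin using (Fin; zero; suc; toℕ; fromℕ<; inject≤; splitAt; join)
open import Data.Fin.Properties as Fin
  using (any?; toℕ-injective; toℕ<n; toℕ-fromℕ<; fromℕ<-toℕ; injective⇒≤; inject≤-injective; join-splitAt)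
open import Data.Fin.Subset as Subset
  using (Subset; _∈_; _⊆_; _⊂_; ∣_∣; ⊤; inside; outside)
open import Data.Fin.Subset.Induction using (⊂-wellFounded)
open import Data.Fin.Subset.Properties
  using (_∈?_; ∈⊤; ∣⊤∣≡n; x∈p∩q⁺; x∈p∩q⁻; ⊆-antisym; x∈p⇒p-x⊂p; p─q⊆p; x∈p∧x≢y⇒x∈p-y)
import Data.Integer as ℤ
import Data.Integer.Properties as ℤ
open import Data.List using (List; []; _∷_; _∷ʳ_; lookup; length; filter; allFin; cartesianProduct)
open import Data.List.Membership.Propositional using () renaming (_∈_ to _∈ₗ_)
open import Data.List.Membership.Propositional.Properties
  using (∈-allFin; ∈-lookup; ∈-filter⁺; ∈-filter⁻; ∈-cartesianProduct⁺)
open import Data.List.Relation.Binary.Permutation.Propositional using (↭-sym; ↭⇒↭ₛ)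
open import Data.List.Relation.Binary.Permutation.Propositional.Properties using (∈-resp-↭)
import Data.List.Relation.Binary.Permutation.Setoid.Properties as Permutation
open import Data.List.Relation.Unary.All as All using (All; []; _∷_)
open import Data.List.Relation.Unary.AllPairs using ([]; _∷_)
open import Data.List.Relation.Unary.Any using (index)
open import Data.List.Relation.Unary.Any.Properties using (lookup-index)
open import Data.List.Relation.Unary.Linked using (Linked; _∷_)
import Data.List.Relation.Unary.Sorted.TotalOrder.Properties as Sorted
open import Data.List.Relation.Unary.Unique.Propositional using (Unique)
import Data.List.Relation.Unary.Unique.Propositional.Properties as Unique
import Data.List.Sort as Sort
open import Data.Nat as ℕ
  using (zero; suc; _+_; _∸_; _<_; z≤n; s≤s; s≤s⁻¹; z<s; _≤?_; _<?_; ⌊_/2⌋)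
open import Data.Nat.Properties hiding (_≟_)
open import Data.Product using (Σ; ∃-syntax; _,_; proj₁; proj₂)
open import Data.Product.Properties using (≡-dec)
open import Data.Rational using (toℚᵘ)
open import Data.Rational.Properties using (toℚᵘ-cancel-≤; toℚᵘ-homo-+; toℚᵘ-homo-*; toℚᵘ-fromℚᵘ)
open import Data.Rational.Unnormalised as ℚᵘ using (mkℚᵘ; *≤*)
import Data.Rational.Unnormalised.Properties as ℚᵘ
open import Data.Sum using (_⊎_; inj₁; inj₂; swap; [_,_]′)
open import Data.Sum.Properties using (inj₁-injective; inj₂-injective) renaming (≡-dec to ⊎-≡-dec)
open import Data.Vec as Vec using ([]; _∷_; here; there)
open import Data.Vec.Properties using (lookup∘tabulate; lookup⇒[]=; []=⇒lookup)
open import Function using (_∘_; id; Injective)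
open import Induction.WellFounded using (Acc; acc)
open import Level using (0ℓ)
open import Relation.Binary using (Rel; Decidable; Symmetric; tri<; tri≈; tri>)
open import Relation.Binary.Construct.Closure.ReflexiveTransitive
  using (Star; ε; _◅_; _◅◅_; reverse; kleisliStar; map)
import Relation.Binary.Construct.On as On
open import Relation.Binary.PropositionalEquality
  using (_≡_; _≢_; refl; sym; trans; cong; cong₂; subst; subst₂; ≢-sym; setoid; module ≡-Reasoning)
open import Relation.Nullary using (Dec; yes; no; ¬_; does; contradiction)
open import Relation.Nullary.Decidable
  using (dec-true; dec-false; decidable-stable; ¬?; _×-dec_; _⊎-dec_)
import Relation.Unary as U

-- Subsets given by decidable predicates.

module _ {n : ℕ} {P : Fin n → Set} (P? : U.Decidable P) where

  opaque
    comprehension : Subset n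
    comprehension = Vec.tabulate (does ∘ P?)

    ∈-comprehension⁺ : ∀ {x} → P x → x ∈ comprehension
    ∈-comprehension⁺ {x} p =
      lookup⇒[]= x comprehension (trans (lookup∘tabulate _ x) (dec-true (P? x) p))

    ∈-comprehension⁻ : ∀ {x} → x ∈ comprehension → P x
    ∈-comprehension⁻ {x} x∈ with P? x | trans (sym (lookup∘tabulate (does ∘ P?) x)) ([]=⇒lookup x∈)
    ... | yes p | _ = p
    ... | no _  | ()

lookup-injective : ∀ {A : Set} {xs : List A} → Unique xs → Injective _≡_ _≡_ (lookup xs)
lookup-injective (_ ∷ _)   {zero}  {zero}  _  = refl
lookup-injective (x∉ ∷ _)  {zero}  {suc j} eq = contradiction eq (All.lookup x∉ (∈-lookup j))
lookup-injective (x∉ ∷ _)  {suc i} {zero}  eq = contradiction (sym eq) (All.lookup x∉ (∈-lookup i))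
lookup-injective (_ ∷ xs!) {suc i} {suc j} eq = cong suc (lookup-injective xs! eq)

-- Edges, walks and spanning forests of a graph.

module _ {n : ℕ} (G : Graph n) where
  open Graph G

  Joins : Edge G → Rel (Fin n) 0ℓ
  Joins e u v = ends G e ≡ (u , v) ⊎ ends G e ≡ (v , u)

  -- `Adj G T` unfolds to `Along (_∈ E T)`, so facts about `Along` apply to subgraphs as they stand.
  Along : (Edge G → Set) → Rel (Fin n) 0ℓ
  Along P u v = ∃[ e ] P e × Joins e u v

  along? : ∀ {P} → U.Decidable P → Decidable (Along P)
  along? P? u v = any? λ e → P? e ×-dec (ends G e ≟ (u , v) ⊎-dec ends G e ≟ (v , u))
    where _≟_ = ≡-dec Fin._≟_ Fin._≟_

  along-sym : ∀ {P} → Symmetric (Along P)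
  along-sym (e , p , j) = e , p , swap j

  along-mono : ∀ {P Q : Edge G → Set} → (∀ {e} → P e → Q e) →
               ∀ {u v} → Star (Along P) u v → Star (Along Q) u v
  along-mono P⊆Q = map λ (e , p , j) → e , P⊆Q p , j

  ends-adjacent : ∀ e → proj₁ (ends G e) Fin.< proj₂ (ends G e) × proj₁ (ends G e) ~ proj₂ (ends G e)
  ends-adjacent e = proj₂ (∈-filter⁻ (λ (u , v) → (u Fin.<? v) ×-dec (u ~? v))
    {xs = cartesianProduct (allFin n) (allFin n)} (∈-lookup e))

  ends-injective : ∀ {e f} → ends G e ≡ ends G f → e ≡ f
  ends-injective = lookup-injective (Unique.filter⁺ _
    (Unique.cartesianProduct⁺ (Unique.allFin⁺ n) (Unique.allFin⁺ n)))

  joins-irrefl : ∀ {e u v} → Joins e u v → u ≢ v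
  joins-irrefl {e} j refl with ends G e | ends-adjacent e | j
  ... | _ | u<u , _ | inj₁ refl = Fin.<-irrefl refl u<u
  ... | _ | u<u , _ | inj₂ refl = Fin.<-irrefl refl u<u

  joins-unique : ∀ {e f u v} → Joins e u v → Joins f u v → e ≡ f
  joins-unique (inj₁ p) (inj₁ q) = ends-injective (trans p (sym q))
  joins-unique (inj₂ p) (inj₂ q) = ends-injective (trans p (sym q))
  joins-unique {e} {f} (inj₁ p) (inj₂ q) with ends G e | ends G f | ends-adjacent e | ends-adjacent f | p | q
  ... | _ | _ | u<v , _ | v<u , _ | refl | refl = contradiction v<u (Fin.<-asym u<v)
  joins-unique {e} {f} (inj₂ p) (inj₁ q) with ends G e | ends G f | ends-adjacent e | ends-adjacent f | p | q
  ... | _ | _ | u<v , _ | v<u , _ | refl | refl = contradiction v<u (Fin.<-asym u<v)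

  joining-edge : ∀ {u v} → u ~ v → ∃[ e ] Joins e u v
  joining-edge {u} {v} u~v with Fin.<-cmp u v
  ... | tri≈ _ u≡v _ = contradiction u~v (~-irrefl u≡v)
  ... | tri< u<v _ _ = index u,v∈ , inj₁ (sym (lookup-index u,v∈))
    where u,v∈ = ∈-filter⁺ (λ (u , v) → (u Fin.<? v) ×-dec (u ~? v))
                   (∈-cartesianProduct⁺ (∈-allFin u) (∈-allFin v)) (u<v , u~v)
  ... | tri> _ _ v<u = index v,u∈ , inj₂ (sym (lookup-index v,u∈))
    where v,u∈ = ∈-filter⁺ (λ (u , v) → (u Fin.<? v) ×-dec (u ~? v))
                   (∈-cartesianProduct⁺ (∈-allFin v) (∈-allFin u)) (v<u , ~-sym u~v)

  joins-ends : ∀ e → Joins e (proj₁ (ends G e)) (proj₂ (ends G e))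
  joins-ends e = inj₁ refl

  incidentˡ : ∀ {e u v} → Joins e u v → Incident G u e
  incidentˡ (inj₁ eq) = inj₁ (cong proj₁ (sym eq))
  incidentˡ (inj₂ eq) = inj₂ (cong proj₂ (sym eq))

  incidentʳ : ∀ {e u v} → Joins e u v → Incident G v e
  incidentʳ = incidentˡ ∘ swap

  incident⇒end : ∀ {e u v x} → Joins e u v → Incident G x e → x ≡ u ⊎ x ≡ v
  incident⇒end (inj₁ eq) (inj₁ refl) = inj₁ (cong proj₁ eq)
  incident⇒end (inj₁ eq) (inj₂ refl) = inj₂ (cong proj₂ eq)
  incident⇒end (inj₂ eq) (inj₁ refl) = inj₂ (cong proj₁ eq)
  incident⇒end (inj₂ eq) (inj₂ refl) = inj₁ (cong proj₂ eq)

  other-end : ∀ {e u} → Incident G u e → ∃[ v ] Joins e u v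
  other-end (inj₁ refl) = _ , inj₁ refl
  other-end (inj₂ refl) = _ , inj₂ refl

  incident-joins : ∀ {e u v} → Incident G u e → Incident G v e → u ≢ v → Joins e u v
  incident-joins u∈e v∈e u≢v with other-end u∈e
  ... | w , j with incident⇒end j v∈e
  ...   | inj₁ v≡u = contradiction (sym v≡u) u≢v
  ...   | inj₂ refl = j

  -- Two distinct common vertices would be the ends of both edges, which are then equal as `G` is
  -- simple. Hence each edge of `L G` lies in the clique of only one vertex of `G`.
  common-vertex-unique : ∀ {e f x y} → e ≢ f → Incident G x e → Incident G x f →
                         Incident G y e → Incident G y f → x ≡ y
  common-vertex-unique {x = x} {y} e≢f xe xf ye yf with x Fin.≟ y
  ... | yes x≡y = x≡y
  ... | no  x≢y = contradiction (joins-unique (incident-joins xe ye x≢y) (incident-joins xf yf x≢y)) e≢f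

  -- The last step of a nonempty walk supplies the edge. This places the vertices of a tree on its
  -- edges and finds an edge of a tree at a given vertex.
  star-end-incident : ∀ {P u v} → Star (Along P) u v → u ≡ v ⊎ ∃[ e ] P e × Incident G v e
  star-end-incident ε = inj₁ refl
  star-end-incident ((e , p , j) ◅ w) with star-end-incident w
  ... | inj₁ refl = inj₂ (e , p , incidentʳ j)
  ... | inj₂ r    = inj₂ r

  -- A cycle without its first edge is still a walk between the ends of that edge, so this edge is
  -- no bridge.
  bridges⇒acyclic : ∀ {P} → (∀ {e u v} → P e → Joins e u v → ¬ Star (Along λ f → P f × f ≢ e) u v) →
                    Acyclic (Along P)
  bridges⇒acyclic h (_ ∷ [] , s≤s () , _)
  bridges⇒acyclic h (_ ∷ _ ∷ [] , s≤s (s≤s ()) , _)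
  bridges⇒acyclic {P} h (x ∷ y ∷ z ∷ zs , _ , ((_ ∷ x≢z ∷ x∉zs) ∷ (y≢z ∷ y∉zs) ∷ _) , (e , p , j) ∷ s ∷ rest) =
    h p (swap j) (avoid s incidentʳ (≢-sym x≢z) (≢-sym y≢z) ◅
                  path rest (≢-sym x≢z) (≢-sym y≢z) x∉zs y∉zs)
    where
    Q : Edge G → Set
    Q f = P f × f ≢ e

    avoid : ∀ {a b c} → Along P a b → (∀ {f} → Joins f a b → Incident G c f) →
            c ≢ x → c ≢ y → Along Q a b
    avoid (f , q , i) c∈ c≢x c≢y =
      f , (q , λ { refl → [ c≢x , c≢y ]′ (incident⇒end j (c∈ i)) }) , i

    -- Each step starts at a vertex other than `x` and `y`, even the last one, which ends in `x`; so
    -- none uses `e`.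
    path : ∀ {a as} → Linked (Along P) (a ∷ as ∷ʳ x) → a ≢ x → a ≢ y →
           All (x ≢_) as → All (y ≢_) as → Star (Along Q) a x
    path {as = []}     (t ∷ _)  a≢x a≢y _  _  = avoid t incidentˡ a≢x a≢y ◅ ε
    path {as = b ∷ bs} (t ∷ ts) a≢x a≢y (x≢b ∷ x∉) (y≢b ∷ y∉) =
      avoid t incidentˡ a≢x a≢y ◅ path ts (≢-sym x≢b) (≢-sym y≢b) x∉ y∉

  opaque
    -- An edge is deleted as long as some edge has its ends joined by the others; the deleted edge
    -- is replaced by that detour in every walk. When no such edge remains, all edges are bridges.
    spanning-forest : ∀ F → ∃[ F′ ] F′ ⊆ F × Acyclic (Along (_∈ F′)) ×
                      (∀ {u v} → Star (Along (_∈ F)) u v → Star (Along (_∈ F′)) u v)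
    spanning-forest F = go F (⊂-wellFounded F)
      where
      go : ∀ F → Acc _⊂_ F → ∃[ F′ ] F′ ⊆ F × Acyclic (Along (_∈ F′)) ×
           (∀ {u v} → Star (Along (_∈ F)) u v → Star (Along (_∈ F′)) u v)
      go F (acc rec) with any? (λ e → (e ∈? F) ×-dec
                            star? (along? (_∈? (F Subset.- e))) (proj₁ (ends G e)) (proj₂ (ends G e)))
      ... | no ¬e = F , id , bridges⇒acyclic bridge , id
        where
        bridge : ∀ {e u v} → e ∈ F → Joins e u v → ¬ Star (Along λ f → f ∈ F × f ≢ e) u v
        bridge {e} e∈ j w = ¬e (e , e∈ , orient j (along-mono (λ (f∈ , f≢e) → x∈p∧x≢y⇒x∈p-y f∈ f≢e) w))
          where
          orient : ∀ {u v} → Joins e u v → Star (Along (_∈ (F Subset.- e))) u v →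
                   Star (Along (_∈ (F Subset.- e))) (proj₁ (ends G e)) (proj₂ (ends G e))
          orient (inj₁ eq) w = subst₂ (Star _) (cong proj₁ (sym eq)) (cong proj₂ (sym eq)) w
          orient (inj₂ eq) w =
            subst₂ (Star _) (cong proj₁ (sym eq)) (cong proj₂ (sym eq)) (reverse along-sym w)
      ... | yes (e , e∈ , detour) with go (F Subset.- e) (rec (x∈p⇒p-x⊂p e∈))
      ...   | F′ , F′⊆ , acyclic , conn =
        F′ , (λ f∈ → p─q⊆p F _ (F′⊆ f∈)) , acyclic , λ w → conn (kleisliStar id step w)
        where
        step : ∀ {u v} → Along (_∈ F) u v → Star (Along (_∈ (F Subset.- e))) u v
        step (f , f∈ , j) with f Fin.≟ e
        step (f , f∈ , j) | no f≢e = (f , x∈p∧x≢y⇒x∈p-y f∈ f≢e , j) ◅ ε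
        step (f , f∈ , inj₁ eq) | yes refl =
          subst₂ (Star _) (cong proj₁ eq) (cong proj₂ eq) detour
        step (f , f∈ , inj₂ eq) | yes refl =
          subst₂ (Star _) (cong proj₂ eq) (cong proj₁ eq) (reverse along-sym detour)

    -- The tree is a spanning forest of the component of `r`. It reduces the search for trees to the
    -- search for sets of edges that connect, without regard to cycles.
    component-tree : ∀ {P} → U.Decidable P → ∀ r →
      ∃[ T ] IsTree G T × (∀ {e} → e ∈ Subgraph.E T → P e)
           × (∀ {v} → v ∈ Subgraph.V T → Star (Along P) r v)
           × (∀ {v} → Star (Along P) r v → v ∈ Subgraph.V T)
    component-tree {P} P? r with
      spanning-forest (comprehension (λ e → P? e ×-dec star? (along? P?) r (proj₁ (ends G e))))
    ... | F′ , F′⊆F , acyclic , conn =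
      mkSubgraph (comprehension reached?) F′ closed ,
      ((λ u v u∈ v∈ → reverse along-sym (conn (from-root (∈-comprehension⁻ reached? u∈)))
                      ◅◅ conn (from-root (∈-comprehension⁻ reached? v∈))) , acyclic) ,
      (λ e∈ → proj₁ (∈-comprehension⁻ F? (F′⊆F e∈))) ,
      ∈-comprehension⁻ reached? , ∈-comprehension⁺ reached?
      where
      reached? : U.Decidable (Star (Along P) r)
      reached? = star? (along? P?) r
      F? : U.Decidable (λ e → P e × Star (Along P) r (proj₁ (ends G e)))
      -- Testing one end is enough: the edge itself leads on to the other end. The test keeps the
      -- edges of other components out, as `closed` requires.
      F? = λ e → P? e ×-dec reached? (proj₁ (ends G e))
      F : Subset (size G)
      F = comprehension F?

      closed : Closed G (comprehension reached?) F′
      closed e e∈ v v∈e with ∈-comprehension⁻ F? (F′⊆F e∈) | v∈e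
      ... | p , w | inj₁ refl = ∈-comprehension⁺ reached? w
      ... | p , w | inj₂ refl = ∈-comprehension⁺ reached? (w ◅◅ (e , p , joins-ends e) ◅ ε)

      stays : ∀ {u v} → Star (Along P) r u → Star (Along P) u v → Star (Along (_∈ F)) u v
      stays _ ε = ε
      stays w (s@(e , p , j) ◅ t) = (e , ∈-comprehension⁺ F? (p , first j) , j) ◅ stays (w ◅◅ s ◅ ε) t
        where
        first : ∀ {u v} → Joins e u v → Star (Along P) r (proj₁ (ends G e))
        first _ with incident⇒end j (inj₁ refl)
        ... | inj₁ eq = subst (Star _ r) (sym eq) w
        ... | inj₂ eq = subst (Star _ r) (sym eq) (w ◅◅ s ◅ ε)

      from-root : ∀ {v} → Star (Along P) r v → Star (Along (_∈ F)) r v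
      from-root = stays ε

  -- Packings from disjoint classes of edges.

  module _ {N : ℕ} {P : Fin N → Edge G → Set} (P? : ∀ i → U.Decidable (P i))
           (P-disjoint : ∀ {i j e} → P i e → P j e → i ≡ j)
           {S : Subset n} {r : Fin n}
           (connects : ∀ i {s} → s ∈ S → Star (Along (P i)) r s) where
    open Subgraph

    private
      tree : Fin N → Subgraph G
      tree i = proj₁ (component-tree (P? i) r)

      tree-connecting : ∀ i → TreeConnecting G S (tree i)
      tree-connecting i =
        let _ , is-tree , _ , _ , V⁺ = component-tree (P? i) r in is-tree , λ s∈ → V⁺ (connects i s∈)

      tree⊆ : ∀ i {e} → e ∈ E (tree i) → P i e
      tree⊆ i = let _ , _ , E⊆ , _ = component-tree (P? i) r in E⊆

      tree-disjoint : ∀ i j → i ≢ j → EdgeDisjoint G (tree i) (tree j)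
      tree-disjoint i j i≢j (e , e∈) =
        let e∈i , e∈j = x∈p∩q⁻ (E (tree i)) (E (tree j)) e∈ in i≢j (P-disjoint (tree⊆ i e∈i) (tree⊆ j e∈j))

    edge-disjoint-packing : Packing G S (EdgeDisjoint G) N
    edge-disjoint-packing = tree , tree-connecting , tree-disjoint

    -- Every vertex of tree `i` other than the root `r` lies on an edge of class `i`, so the sets
    -- `W i` control where two trees can meet.
    internally-disjoint-packing :
      r ∈ S → {W : Fin N → Fin n → Set} →
      (∀ {i e v} → P i e → Incident G v e → W i v) →
      (∀ {i j v} → i ≢ j → W i v → W j v → v ∈ S) →
      Packing G S (InternallyDisjoint G S) N
    internally-disjoint-packing r∈ {W} P⊆W W-disjoint = tree , tree-connecting , λ i j i≢j →
      tree-disjoint i j i≢j ,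
      ⊆-antisym (λ v∈ → let v∈i , v∈j = x∈p∩q⁻ (V (tree i)) (V (tree j)) v∈
                        in meet i≢j (in-W i v∈i) (in-W j v∈j))
                (λ s∈ → x∈p∩q⁺ (proj₂ (tree-connecting i) s∈ , proj₂ (tree-connecting j) s∈))
      where
      in-W : ∀ i {v} → v ∈ V (tree i) → r ≡ v ⊎ W i v
      in-W i v∈ =
        let _ , _ , _ , V⁻ , _ = component-tree (P? i) r
        in [ inj₁ , (λ (_ , p , v∈e) → inj₂ (P⊆W p v∈e)) ]′ (star-end-incident (V⁻ v∈))

      meet : ∀ {i j v} → i ≢ j → r ≡ v ⊎ W i v → r ≡ v ⊎ W j v → v ∈ S
      meet i≢j (inj₁ refl) _           = r∈
      meet i≢j (inj₂ _)    (inj₁ refl) = r∈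
      meet i≢j (inj₂ w)    (inj₂ w′)   = W-disjoint i≢j w w′

module _ {n k : ℕ} {G : Graph n} (T : Fin k → Subgraph G)
         (T-disjoint : ∀ i j → i ≢ j → EdgeDisjoint G (T i) (T j)) where
  open Subgraph

  tree-unique : ∀ {i j f} → f ∈ E (T i) → f ∈ E (T j) → i ≡ j
  tree-unique {i} {j} f∈i f∈j with i Fin.≟ j
  ... | yes i≡j = i≡j
  ... | no  i≢j = contradiction (_ , x∈p∩q⁺ (f∈i , f∈j)) (T-disjoint i j i≢j)

-- Walecki's zigzag paths in a complete graph.

data Halving : ℕ → Set where
  even : ∀ q → Halving (q + q)
  odd  : ∀ q → Halving (suc (q + q))

halve : ∀ n → Halving n
halve zero = even 0
halve (suc n) with halve n
... | even q = odd q
... | odd q  = subst Halving (cong suc (+-suc q q)) (even (suc q))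

odd? : ℕ → Bool
odd? zero    = false
odd? (suc n) = not (odd? n)

odd?-double : ∀ q → odd? (q + q) ≡ false
odd?-double zero = refl
odd?-double (suc q) rewrite +-suc q q | odd?-double q = refl

half-suc-double : ∀ q → ⌊ suc (q + q) /2⌋ ≡ q
half-suc-double zero = refl
half-suc-double (suc q) rewrite +-suc q q = cong suc (half-suc-double q)

-- Reduction modulo d of a number below 2 d.
wrap : ℕ → ℕ → ℕ
wrap d t = if does (t <? d) then t else t ∸ d

wrap-< : ∀ {d t} → t < d → wrap d t ≡ t
wrap-< {d} {t} t<d rewrite dec-true (t <? d) t<d = refl

wrap-+ : ∀ d t → wrap d (t + d) ≡ t
wrap-+ d t rewrite dec-false (t + d <? d) (≤⇒≯ (m≤n+m d t)) = m+n∸n≡m t d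

module Zigzag (d : ℕ) where

  -- The positions 0, 1, 2, 3, 4, … carry the residues 0, 1, -1, 2, -2, … modulo d.
  label : ℕ → ℕ
  label p = if odd? p then suc ⌊ p /2⌋ else wrap d (d ∸ ⌊ p /2⌋)

  label-even : ∀ q → label (q + q) ≡ wrap d (d ∸ q)
  label-even q rewrite odd?-double q | sym (n≡⌊n+n/2⌋ q) = refl

  label-odd : ∀ q → label (suc (q + q)) ≡ suc q
  label-odd q rewrite odd?-double q | half-suc-double q = refl

  label-0 : label 0 ≡ 0
  -- Position 0 gives `d ∸ 0`, the one label for which `wrap` has to subtract `d`.
  label-0 = wrap-+ d 0

  label-even⁺ : ∀ q → q < d → label (suc q + suc q) ≡ d ∸ suc q
  label-even⁺ q q<d = trans (label-even (suc q)) (wrap-< (∸-monoʳ-< z<s q<d))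

  private
    back-label : ∀ q → suc q + suc q < d → q < d × label (suc q + suc q) + suc q ≡ d
    back-label q lt = q<d , trans (cong (_+ suc q) (label-even⁺ q q<d)) (m∸n+n≡m q<d)
      where q<d = ≤-trans (m≤m+n (suc q) (suc q)) (<⇒≤ lt)

    -- Even positions after 0 carry labels above `d / 2`, odd positions labels of at most `d / 2`.
    label-split : ∀ {a q r} → a + q ≡ d → q + q < d → suc (r + r) < d → a ≢ suc r
    label-split {q = q} {r} eq lt lt′ refl = <-irrefl refl (begin-strict
      q     <⟨ +-cancelʳ-< q q (suc r) (subst (q + q <_) (sym eq) lt) ⟩
      suc r ≤⟨ +-cancelˡ-≤ (suc r) (suc r) q (subst₂ _≤_ (cong suc (sym (+-suc r r))) (sym eq) lt′) ⟩
      q     ∎)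
      where open ≤-Reasoning

  label-bounded : ∀ {p} → p < d → label p < d
  label-bounded {p} p<d with halve p
  ... | even zero = subst (_< d) (sym label-0) p<d
  ... | even (suc q) = subst (_< d) (sym (label-even⁺ q (proj₁ (back-label q p<d))))
                         (∸-monoʳ-< z<s (proj₁ (back-label q p<d)))
  ... | odd q = subst (_< d) (sym (label-odd q)) (≤-<-trans (s≤s (m≤m+n q q)) p<d)

  label-injective : ∀ {p q} → p < d → q < d → label p ≡ label q → p ≡ q
  label-injective {p} {q} p<d q<d eq with halve p | halve q
  ... | even zero | even zero = refl
  ... | even zero | even (suc r) = contradiction
    (trans (sym (label-even⁺ r (proj₁ (back-label r q<d)))) (trans (sym eq) label-0))
    (m>n⇒m∸n≢0 (≤-<-trans (m≤m+n (suc r) (suc r)) q<d))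
  ... | even zero | odd r with () ← trans (sym label-0) (trans eq (label-odd r))
  ... | even (suc r) | even zero = contradiction
    (trans (sym (label-even⁺ r (proj₁ (back-label r p<d)))) (trans eq label-0))
    (m>n⇒m∸n≢0 (≤-<-trans (m≤m+n (suc r) (suc r)) p<d))
  ... | even (suc r) | even (suc t) = cong (λ x → x + x) (+-cancelˡ-≡ (label (suc r + suc r)) (suc r) (suc t)
    (trans (proj₂ (back-label r p<d))
           (sym (trans (cong (_+ suc t) eq) (proj₂ (back-label t q<d))))))
  ... | even (suc r) | odd t =
    contradiction (trans eq (label-odd t)) (label-split (proj₂ (back-label r p<d)) p<d q<d)
  ... | odd r | even zero with () ← trans (sym label-0) (trans (sym eq) (label-odd r))
  ... | odd r | even (suc t) =
    contradiction (trans (sym eq) (label-odd r)) (label-split (proj₂ (back-label t q<d)) q<d p<d)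
  ... | odd r | odd t = cong (λ x → suc (x + x))
    (suc-injective (trans (sym (label-odd r)) (trans eq (label-odd t))))

  -- A positive label of at most `d / 2` sits at an odd position. A larger one is counted back from
  -- `d` and sits at an even position.
  label-surjective : ∀ {a} → a < d → ∃[ p ] p < d × label p ≡ a
  label-surjective {zero} 0<d = 0 , 0<d , label-0
  label-surjective {suc b} a<d with suc (b + b) <? d
  ... | yes p<d = suc (b + b) , p<d , label-odd b
  ... | no ¬p<d with d ∸ suc b in eq
  ...   | zero = contradiction eq (m>n⇒m∸n≢0 a<d)
  ...   | suc q = suc q + suc q , p<d , +-cancelʳ-≡ (suc q) _ _
                    (trans (proj₂ (back-label q p<d)) (sym (trans (+-comm (suc b) (suc q)) d≡)))
    where
    d≡ : suc q + suc b ≡ d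
    d≡ = trans (cong (_+ suc b) (sym eq)) (m∸n+n≡m (<⇒≤ a<d))

    p<d : suc q + suc q < d
    p<d = subst (suc q + suc q <_) d≡ (+-monoʳ-< (suc q)
      (s≤s (+-cancelʳ-≤ (suc b) (suc q) b
        (≤-trans (≤-reflexive d≡) (≤-trans (≮⇒≥ ¬p<d) (≤-reflexive (sym (+-suc b b))))))))

  -- The pairs of labels with sum s or s + 1 modulo d form a path through all of ℤ/d, since
  -- a and a + 1 both add up with s - a to one of the two sums. For s = 0 this path visits the
  -- positions in their order.
  colour : ℕ → ℕ → ℕ
  colour p q = ⌊ wrap d (label p + label q) /2⌋

  colour-comm : ∀ p q → colour p q ≡ colour q p
  colour-comm p q = cong (λ t → ⌊ wrap d t /2⌋) (+-comm (label p) (label q))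

  -- Sums of neighbouring labels alternate between 1 and 0 modulo `d`, and both halve to 0.
  colour-consecutive : ∀ p → suc p < d → colour p (suc p) ≡ 0
  colour-consecutive p lt with halve p
  ... | even zero rewrite label-0 | wrap-< lt = refl
  ... | even (suc q) = cong ⌊_/2⌋ (trans (cong (wrap d) sum) (wrap-+ d 1))
    where
    sum : label (suc q + suc q) + label (suc (suc q + suc q)) ≡ 1 + d
    sum = begin
      label (suc q + suc q) + label (suc (suc q + suc q)) ≡⟨ cong (λ t → label (suc q + suc q) + t) (label-odd (suc q)) ⟩
      label (suc q + suc q) + suc (suc q)                 ≡⟨ +-suc _ (suc q) ⟩
      1 + (label (suc q + suc q) + suc q)                 ≡⟨ cong suc (proj₂ (back-label q (<-trans (n<1+n _) lt))) ⟩
      1 + d                                               ∎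
      where open ≡-Reasoning
  ... | odd q = cong ⌊_/2⌋ (trans (cong (wrap d) sum) (wrap-+ d 0))
    where
    sum : label (suc (q + q)) + label (suc (suc (q + q))) ≡ d
    sum = begin
      label (suc (q + q)) + label (suc (suc (q + q))) ≡⟨ cong₂ (λ x p → x + label (suc p)) (label-odd q) (sym (+-suc q q)) ⟩
      suc q + label (suc q + suc q)                   ≡⟨ +-comm (suc q) _ ⟩
      label (suc q + suc q) + suc q                   ≡⟨ proj₂ (back-label q (subst (λ p → suc p < d) (sym (+-suc q q)) lt)) ⟩
      d                                               ∎
      where open ≡-Reasoning

  module _ (c : ℕ) where

    Coloured : Rel ℕ 0ℓ
    Coloured p q = p < d × q < d × p ≢ q × colour p q ≡ c

    coloured-sym : Symmetric Coloured
    coloured-sym {p} {q} (p< , q< , p≢q , eq) = q< , p< , ≢-sym p≢q , trans (colour-comm q p) eq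

    private
      -- Covers the case that a residue is its own complement, where the step is empty.
      link : ∀ {p q} → p < d → q < d → colour p q ≡ c → Star Coloured p q
      link {p} {q} p< q< eq with p ℕ.≟ q
      ... | yes refl = ε
      ... | no p≢q   = (p< , q< , p≢q , eq) ◅ ε

      -- The residue `b` is `s - a`, with `d` added when `a` exceeds `s`. It serves both `a` and
      -- `a + 1` and so is the midpoint of a two-step walk between them.
      complement : ∀ {a s} → a < d → s < d →
                   ∃[ b ] b < d × wrap d (a + b) ≡ s × (suc s < d → wrap d (suc a + b) ≡ suc s)
      complement {a} {s} a<d s<d with a ≤? s
      ... | yes a≤s = s ∸ a , ≤-<-trans (m∸n≤m s a) s<d ,
            trans (cong (wrap d) (m+[n∸m]≡n a≤s)) (wrap-< s<d) ,
            λ lt → trans (cong (λ t → wrap d (suc t)) (m+[n∸m]≡n a≤s)) (wrap-< lt)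
      ... | no a≰s = s + d ∸ a , b<d ,
            trans (cong (wrap d) a+b≡s+d) (wrap-+ d s) ,
            λ _ → trans (cong (λ t → wrap d (suc t)) a+b≡s+d) (wrap-+ d (suc s))
        where
        a+b≡s+d : a + (s + d ∸ a) ≡ s + d
        a+b≡s+d = m+[n∸m]≡n (≤-trans (<⇒≤ a<d) (m≤n+m d s))

        b<d : s + d ∸ a < d
        b<d = +-cancelˡ-< a _ _ (subst (_< a + d) (sym a+b≡s+d) (+-monoˡ-< d (≰⇒> a≰s)))

    -- The bound makes both sums of colour `c`, namely `2 c` and `2 c + 1`, residues modulo `d`.
    module _ (c< : suc (c + c) < d) where

      private
        0<d : 0 < d
        0<d = ≤-<-trans z≤n c<

        successive : ∀ {p r} → p < d → r < d → label r ≡ suc (label p) → Star Coloured p r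
        successive {p} {r} p< r< eq =
          let b , b<d , sum , sum⁺ = complement {s = c + c} (label-bounded p<) (<-trans (n<1+n _) c<)
              q , q< , label-q = label-surjective b<d
          in link p< q< (trans (cong (λ x → ⌊ wrap d (label p + x) /2⌋) label-q)
                          (trans (cong ⌊_/2⌋ sum) (sym (n≡⌊n+n/2⌋ c))))
             ◅◅ link q< r< (trans (cong₂ (λ x y → ⌊ wrap d (x + y) /2⌋) label-q eq)
                          (trans (cong (λ t → ⌊ wrap d t /2⌋) (+-comm b _))
                          (trans (cong ⌊_/2⌋ (sum⁺ c<)) (half-suc-double c))))

        from-origin : ∀ a {p} → p < d → label p ≡ a → Star Coloured 0 p
        from-origin zero p< eq with label-injective 0<d p< (trans label-0 (sym eq))
        ... | refl = ε
        from-origin (suc a) {p} p< eq =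
          let q , q< , label-q = label-surjective {a} (<-trans (n<1+n a) (subst (_< d) eq (label-bounded p<)))
          in from-origin a q< label-q ◅◅ successive q< p< (trans eq (cong suc (sym label-q)))

      coloured-connected : ∀ {p q} → p < d → q < d → Star Coloured p q
      coloured-connected p< q< = reverse coloured-sym (from-origin _ p< refl) ◅◅ from-origin _ q< refl

-- Allocation of the edges of the line graph to trees and layers.

position : ∀ {n} → Fin n → List (Fin n) → ℕ
-- An element that is not listed gets the length of the list, which is no position.
position f []       = 0
position f (g ∷ gs) = if does (f Fin.≟ g) then 0 else suc (position f gs)

position-lookup : ∀ {n} {xs : List (Fin n)} → Unique xs → ∀ i → position (lookup xs i) xs ≡ toℕ i
position-lookup {xs = x ∷ xs} _          zero    rewrite dec-true (x Fin.≟ x) refl = refl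
position-lookup {xs = x ∷ xs} (x∉ ∷ xs!) (suc i)
  rewrite dec-false (lookup xs i Fin.≟ x) (λ eq → All.lookup x∉ (∈-lookup i) (sym eq)) =
  cong suc (position-lookup xs! i)

module _ {n : ℕ} (G : Graph n) where

  opaque
    joining-edgeᴸ : ∀ {f g x} → f ≢ g → Incident G x f → Incident G x g → ∃[ b ] Joins (L G) b f g
    joining-edgeᴸ {f} {g} {x} f≢g xf xg = joining-edge (L G) {f} {g} (f≢g , x , xf , xg)

    meet : ∀ b → let f , g = ends (L G) b in ∃[ x ] f ≢ g × Incident G x f × Incident G x g
    meet b = let _ , f≢g , x , xf , xg = ends-adjacent (L G) b in x , f≢g , xf , xg

module Allocation {n t k : ℕ} (G : Graph n)
  (e : Fin t → Edge G) (e-injective : Injective _≡_ _≡_ e)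
  (v u : Fin t → Fin n) (v-injective : Injective _≡_ _≡_ v)
  (e-joins : ∀ l → Joins G (e l) (v l) (u l))
  (T : Fin k → Subgraph G) (T-disjoint : ∀ i j → i ≢ j → EdgeDisjoint G (T i) (T j)) where
  open Subgraph

  opaque
    -- Edges outside all the trees get the key k.
    key : Edge G → ℕ
    key f with any? (λ i → f ∈? E (T i))
    ... | yes (i , _) = toℕ i
    ... | no _        = k

    key⁺ : ∀ {i f} → f ∈ E (T i) → key f ≡ toℕ i
    key⁺ {i} {f} f∈ with any? (λ i → f ∈? E (T i))
    ... | yes (j , f∈j) = cong toℕ (tree-unique T T-disjoint f∈j f∈)
    ... | no ¬f         = contradiction (i , f∈) ¬f

    key⁻ : ∀ {i f} → key f ≡ toℕ i → f ∈ E (T i)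
    key⁻ {i} {f} eq with any? (λ i → f ∈? E (T i))
    ... | yes (j , f∈j) = subst (λ i → f ∈ E (T i)) (toℕ-injective eq) f∈j
    ... | no _          = contradiction (toℕ<n i) (<-irrefl (sym eq))

  -- At its chosen end `v l` the edge `e l` is kept out of the list and serves as a hub for all
  -- trees. At its other end it is listed like any other edge.
  Detached : Edge G → Fin n → Set
  Detached f x = ∃[ l ] e l ≡ f × v l ≡ x

  opaque
    detached? : ∀ f x → Dec (Detached f x)
    detached? f x = any? λ l → (e l Fin.≟ f) ×-dec (v l Fin.≟ x)

  -- As the `v l` are distinct, each vertex has at most one detached edge.
  detached-unique : ∀ {f g x} → Detached f x → Detached g x → f ≡ g
  detached-unique (l , refl , refl) (m , refl , eq) = cong e (sym (v-injective eq))

  open Sort (On.decTotalOrder ≤-decTotalOrder key) using (sort; sort-↭; sort-↗)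

  InStar : Fin n → Edge G → Set
  InStar x f = Incident G x f × ¬ Detached f x

  inStar? : ∀ x → U.Decidable (InStar x)
  inStar? x f = incident? G x f ×-dec ¬? (detached? f x)

  opaque
    -- Sorting by key makes the edges of each tree at x contiguous.
    star : Fin n → List (Edge G)
    star x = filter (inStar? x) (sort (allFin (size G)))

    ∈-star⁺ : ∀ {x f} → InStar x f → f ∈ₗ star x
    ∈-star⁺ {x} {f} = ∈-filter⁺ (inStar? x) (∈-resp-↭ (↭-sym (sort-↭ (allFin (size G)))) (∈-allFin f))

    ∈-star⁻ : ∀ {x f} → f ∈ₗ star x → InStar x f
    ∈-star⁻ {x} f∈ = proj₂ (∈-filter⁻ (inStar? x) {xs = sort (allFin (size G))} f∈)

    star-unique : ∀ x → Unique (star x)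
    star-unique x = Unique.filter⁺ (inStar? x)
      (Permutation.Unique-resp-↭ (setoid _) (↭⇒↭ₛ (↭-sym (sort-↭ (allFin (size G))))) (Unique.allFin⁺ (size G)))

    star-monotone : ∀ x {i j} → i Fin.≤ j → key (lookup (star x) i) ≤ key (lookup (star x) j)
    star-monotone x {i} {j} i≤j = Sorted.lookup-mono-≤ (On.totalOrder ≤-totalOrder key)
      (Sorted.filter⁺ (On.totalOrder ≤-totalOrder key) (inStar? x) (sort-↗ (allFin (size G)))) {i} {j} i≤j

  -- At v l this is one less than the degree in G.
  degree : Fin n → ℕ
  degree x = length (star x)

  at : ∀ x p → .(p < degree x) → Edge G
  at x p p< = lookup (star x) (fromℕ< p<)

  at-inStar : ∀ x p .(p< : p < degree x) → InStar x (at x p p<)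
  at-inStar x p p< = ∈-star⁻ (∈-lookup (fromℕ< p<))

  at-monotone : ∀ x {p q} .(p< : p < degree x) .(q< : q < degree x) → p ≤ q →
                key (at x p p<) ≤ key (at x q q<)
  at-monotone x p< q< p≤q =
    star-monotone x (subst₂ _≤_ (sym (toℕ-fromℕ< p<)) (sym (toℕ-fromℕ< q<)) p≤q)

  position-at : ∀ x p .(p< : p < degree x) → position (at x p p<) (star x) ≡ p
  position-at x p p< = trans (position-lookup (star-unique x) (fromℕ< p<)) (toℕ-fromℕ< p<)

  at-surjective : ∀ {x f} → InStar x f → ∃[ p ] Σ (p < degree x) λ p< → at x p p< ≡ f
  at-surjective {x} {f} f∈ = toℕ i , toℕ<n i ,
    trans (cong (lookup (star x)) (fromℕ<-toℕ i (toℕ<n i))) (sym (lookup-index (∈-star⁺ f∈)))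
    where i = index (∈-star⁺ f∈)

  degree-bound : ∀ {x p} (f : Fin p → Edge G) → Injective _≡_ _≡_ f → (∀ i → Incident G x (f i)) →
                 p ≤ suc (degree x)
  degree-bound {x} {p} f f-injective f∋x = injective⇒≤ {f = λ i → code (detached? (f i) x)} code-injective
    where
    code : ∀ {i} → Dec (Detached (f i) x) → Fin (suc (degree x))
    -- At most one of the edges is detached at `x`, so the additional value `zero` is taken at most
    -- once.
    code (yes _)     = zero
    code {i} (no ¬d) = suc (index (∈-star⁺ (f∋x i , ¬d)))

    code-injective : ∀ {i j} → code (detached? (f i) x) ≡ code (detached? (f j) x) → i ≡ j
    code-injective {i} {j} eq with detached? (f i) x | detached? (f j) x
    ... | yes d | yes d′ = f-injective (detached-unique d d′)
    ... | no ¬d | no ¬d′ = f-injective (trans (lookup-index (∈-star⁺ (f∋x i , ¬d)))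
      (trans (cong (lookup (star x)) (Fin.suc-injective eq)) (sym (lookup-index (∈-star⁺ (f∋x j , ¬d′))))))

  colour : Fin n → Edge G → Edge G → ℕ
  colour x f g = Zigzag.colour (degree x) (position f (star x)) (position g (star x))

  colour-comm : ∀ x f g → colour x f g ≡ colour x g f
  colour-comm x f g = Zigzag.colour-comm (degree x) (position f (star x)) (position g (star x))

  -- Where the key changes along the list, a pair of colour 0 is left to no tree. Listed neighbours
  -- that both have key `k` get the class `inj₁ k`, which is no tree's either.
  SameTree : Fin n → Edge G → Edge G → Set
  SameTree x f g = colour x f g ≡ 0 × key f ≡ key g

  opaque
    sameTree? : ∀ x f g → Dec (SameTree x f g)
    sameTree? x f g = (colour x f g ℕ.≟ 0) ×-dec (key f ℕ.≟ key g)

  -- The class of the edge of the line graph between two edges f and g that meet in x: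
  -- inj₁ i is tree i, and inj₂ c with c ≥ 1 is layer c. Class inj₂ 0 is not used.
  class : Fin n → Edge G → Edge G → ℕ ⊎ ℕ
  class x f g with detached? f x | detached? g x | sameTree? x f g
  ... | yes _ | _     | _     = inj₁ (key g)
  ... | no _  | yes _ | _     = inj₁ (key f)
  ... | no _  | no _  | yes _ = inj₁ (key f)
  ... | no _  | no _  | no _  = inj₂ (colour x f g)

  -- An edge of `L G` has no direction. The one asymmetric case, both edges detached at `x`, would
  -- make them equal.
  class-comm : ∀ {x f g} → f ≢ g → class x f g ≡ class x g f
  class-comm {x} {f} {g} f≢g with detached? f x | detached? g x | sameTree? x f g | sameTree? x g f
  ... | yes d | yes d′ | _           | _           = contradiction (detached-unique d d′) f≢g
  ... | yes _ | no _   | _           | _           = refl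
  ... | no _  | yes _  | _           | _           = refl
  ... | no _  | no _   | yes (_ , eq) | yes _       = cong inj₁ eq
  ... | no _  | no _   | no _        | no _        = cong inj₂ (colour-comm x f g)
  ... | no _  | no _   | yes (c , eq) | no ¬s       = contradiction (trans (colour-comm x g f) c , sym eq) ¬s
  ... | no _  | no _   | no ¬s       | yes (c , eq) = contradiction (trans (colour-comm x f g) c , sym eq) ¬s

  class-detached : ∀ {x f g} → Detached f x → class x f g ≡ inj₁ (key g)
  class-detached {x} {f} {g} d with detached? f x | detached? g x | sameTree? x f g
  ... | yes _ | _ | _ = refl
  ... | no ¬d | _ | _ = contradiction d ¬d

  class-tree : ∀ {x f g} → InStar x f → InStar x g → SameTree x f g → class x f g ≡ inj₁ (key f)
  class-tree {x} {f} {g} (_ , ¬d) (_ , ¬d′) s with detached? f x | detached? g x | sameTree? x f g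
  ... | yes d | _     | _     = contradiction d ¬d
  ... | no _  | yes d | _     = contradiction d ¬d′
  ... | no _  | no _  | yes _ = refl
  ... | no _  | no _  | no ¬s = contradiction s ¬s

  class-layer : ∀ {x f g c} → InStar x f → InStar x g → colour x f g ≡ suc c → class x f g ≡ inj₂ (suc c)
  class-layer {x} {f} {g} (_ , ¬d) (_ , ¬d′) eq with detached? f x | detached? g x | sameTree? x f g
  ... | yes d | _     | _           = contradiction d ¬d
  ... | no _  | yes d | _           = contradiction d ¬d′
  ... | no _  | no _  | yes (c , _) with () ← trans (sym c) eq
  ... | no _  | no _  | no _        = cong inj₂ eq

  class-tree⁻ : ∀ {x f g j} → class x f g ≡ inj₁ j →
                (key f ≡ j ⊎ Detached f x) × (key g ≡ j ⊎ Detached g x)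
  class-tree⁻ {x} {f} {g} eq with detached? f x | detached? g x | sameTree? x f g
  class-tree⁻ refl | yes d | _     | _            = inj₂ d , inj₁ refl
  class-tree⁻ refl | no _  | yes d | _            = inj₁ refl , inj₂ d
  class-tree⁻ refl | no _  | no _  | yes (_ , eq) = inj₁ refl , inj₁ (sym eq)
  class-tree⁻ ()   | no _  | no _  | no _

  opaque
    owner : Edge (L G) → ℕ ⊎ ℕ
    owner b = let f , g = ends (L G) b in class (proj₁ (meet G b)) f g

    -- The choices behind `owner` do not matter: the common vertex is unique, and `class` is
    -- symmetric on distinct edges.
    owner-class : ∀ {b f g x} → Joins (L G) b f g → Incident G x f → Incident G x g → owner b ≡ class x f g
    owner-class {b} {f} {g} {x} j xf xg = go (meet G b) j
      where
      go : ∀ {f′ g′} (m : ∃[ y ] f′ ≢ g′ × Incident G y f′ × Incident G y g′) →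
           (f′ , g′) ≡ (f , g) ⊎ (f′ , g′) ≡ (g , f) → class (proj₁ m) f′ g′ ≡ class x f g
      go (y , f≢g , yf , yg) (inj₁ refl) =
        cong (λ z → class z f g) (common-vertex-unique G f≢g yf yg xf xg)
      go (y , g≢f , yg , yf) (inj₂ refl) =
        trans (cong (λ z → class z g f) (common-vertex-unique G g≢f yg yf xg xf)) (class-comm g≢f)

    owner-ends : ∀ {b j f} → owner b ≡ inj₁ j → Incident (L G) f b → key f ≡ j ⊎ ∃[ l ] e l ≡ f
    owner-ends {b} eq (inj₁ refl) = [ inj₁ , (λ (l , el , _) → inj₂ (l , el)) ]′ (proj₁ (class-tree⁻ eq))
    owner-ends {b} eq (inj₂ refl) = [ inj₁ , (λ (l , el , _) → inj₂ (l , el)) ]′ (proj₂ (class-tree⁻ eq))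

  Owned : ℕ ⊎ ℕ → Edge (L G) → Set
  Owned o b = owner b ≡ o

  infixr 5 _⟫_

  opaque
    Reach : ℕ ⊎ ℕ → Edge G → Edge G → Set
    Reach o = Star (Along (L G) (Owned o))

    reach-refl : ∀ {o f} → Reach o f f
    reach-refl = ε

    reach-sym : ∀ {o f g} → Reach o f g → Reach o g f
    reach-sym = reverse (along-sym (L G))

    _⟫_ : ∀ {o f g h} → Reach o f g → Reach o g h → Reach o f h
    _⟫_ = _◅◅_

    reach⇒star : ∀ {o f g} → Reach o f g → Star (Along (L G) (Owned o)) f g
    reach⇒star r = r

    link : ∀ {o x f g} → f ≢ g → Incident G x f → Incident G x g → class x f g ≡ o → Reach o f g
    link f≢g xf xg eq =
      let b , j = joining-edgeᴸ G f≢g xf xg in (b , trans (owner-class {b} j xf xg) eq , j) ◅ ε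

  at-distinct : ∀ x {p q} .(p< : p < degree x) .(q< : q < degree x) → p ≢ q → at x p p< ≢ at x q q<
  at-distinct x {p} {q} p< q< p≢q eq =
    p≢q (trans (sym (position-at x p p<)) (trans (cong (λ f → position f (star x)) eq) (position-at x q q<)))

  colour-at : ∀ x {p q} .(p< : p < degree x) .(q< : q < degree x) →
              colour x (at x p p<) (at x q q<) ≡ Zigzag.colour (degree x) p q
  colour-at x {p} {q} p< q< = cong₂ (Zigzag.colour (degree x)) (position-at x p p<) (position-at x q q<)

  -- The zigzag of colour `c + 1` runs through all positions at `x`, and a pair of listed edges with
  -- positive colour never goes to a tree.
  layer-star : ∀ {c x f g} → suc (suc c + suc c) < degree x → InStar x f → InStar x g →
               Reach (inj₂ (suc c)) f g
  layer-star {c} {x} c< f∈ g∈ with at-surjective f∈ | at-surjective g∈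
  ... | p , p< , refl | q , q< , refl = go p< q< (Zigzag.coloured-connected (degree x) (suc c) c< p< q<)
    where
    go : ∀ {p q} .(p< : p < degree x) .(q< : q < degree x) →
         Star (Zigzag.Coloured (degree x) (suc c)) p q → Reach (inj₂ (suc c)) (at x p p<) (at x q q<)
    go p< q< ε = reach-refl
    go {p} p< q< (_◅_ {j = r} (_ , r< , p≢r , eq) w) =
      link (at-distinct x p< r< p≢r) (proj₁ (at-inStar x p p<)) (proj₁ (at-inStar x r r<))
           (class-layer (at-inStar x p p<) (at-inStar x r r<) (trans (colour-at x p< r<) eq))
      ⟫ go r< q< w

  -- An edge `h` other than the `e l` is listed at both of its ends, so it carries the layer from
  -- one clique to the next.
  layer-walk : ∀ {c} → (∀ x → suc (suc c + suc c) < degree x) →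
               ∀ {x y f g} → Star (Along G λ h → ∀ l → e l ≢ h) x y → InStar x f → InStar y g →
               Reach (inj₂ (suc c)) f g
  layer-walk c< ε f∈ g∈ = layer-star (c< _) f∈ g∈
  layer-walk c< ((h , h≢e , j) ◅ w) f∈ g∈ =
    layer-star (c< _) f∈ (incidentˡ G j , λ (l , eq , _) → h≢e l eq)
    ⟫ layer-walk c< w (incidentʳ G j , λ (l , eq , _) → h≢e l eq) g∈

  layer-connects : ∀ {c} → (∀ x → suc (suc c + suc c) < degree x) →
                   (∀ x y → Star (Along G λ h → ∀ l → e l ≢ h) x y) →
                   ∀ l m → Reach (inj₂ (suc c)) (e l) (e m)
  -- The edge `e l` is detached at `v l`, so the layer reaches it in the clique at `u l`.
  layer-connects c< walks l m = layer-walk c< (walks (u l) (u m)) (e-inStar l) (e-inStar m)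
    where
    e-inStar : ∀ l → InStar (u l) (e l)
    e-inStar l = incidentʳ G (e-joins l) ,
      λ (l′ , eq , v≡u) → joins-irrefl G (e-joins l) (trans (cong v (sym (e-injective eq))) v≡u)

  -- Keys increase weakly along the list, so all positions between two of key `j` have key `j`.
  -- Neighbouring positions have colour 0 and are therefore linked in tree `j`.
  tree-run : ∀ x d {p q j} .(p< : p < degree x) (q< : q < degree x) → d + p ≡ q →
             key (at x p p<) ≡ j → key (at x q q<) ≡ j → Reach (inj₁ j) (at x p p<) (at x q q<)
  tree-run x zero    p< q< refl _ _ = reach-refl
  tree-run x (suc d) {p} {q} p< q< eq key-p key-q =
    link (at-distinct x p< sp< (<⇒≢ ≤-refl)) (proj₁ (at-inStar x p p<)) (proj₁ (at-inStar x (suc p) sp<))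
         (trans (class-tree (at-inStar x p p<) (at-inStar x (suc p) sp<)
                  (trans (colour-at x p< sp<) (Zigzag.colour-consecutive (degree x) p sp<) ,
                   trans key-p (sym key-sp))) (cong inj₁ key-p))
    ⟫ tree-run x d sp< q< (trans (+-suc d p) eq) key-sp key-q
    where
    sp≤q : suc p ≤ q
    sp≤q = ≤-trans (s≤s (m≤n+m p d)) (≤-reflexive eq)

    sp< : suc p < degree x
    sp< = ≤-<-trans sp≤q q<

    key-sp : key (at x (suc p) sp<) ≡ _
    key-sp = ≤-antisym (≤-trans (at-monotone x sp< q< sp≤q) (≤-reflexive key-q))
                    (≤-trans (≤-reflexive (sym key-p)) (at-monotone x p< sp< (n≤1+n p)))

  tree-star : ∀ {x f g j} → InStar x f → InStar x g → key f ≡ j → key g ≡ j → Reach (inj₁ j) f g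
  tree-star {x} f∈ g∈ key-f key-g with at-surjective f∈ | at-surjective g∈
  ... | p , p< , refl | q , q< , refl with ≤-total p q
  ...   | inj₁ p≤q = tree-run x (q ∸ p) p< q< (m∸n+n≡m p≤q) key-f key-g
  ...   | inj₂ q≤p = reach-sym (tree-run x (p ∸ q) q< p< (m∸n+n≡m q≤p) key-g key-f)

  tree-spoke : ∀ {x f g j} → Detached f x → Incident G x f → Incident G x g → key g ≡ j → Reach (inj₁ j) f g
  tree-spoke {f = f} {g} d xf xg key-g with f Fin.≟ g
  ... | yes refl = reach-refl
  ... | no  f≢g  = link f≢g xf xg (trans (class-detached d) (cong inj₁ key-g))

  tree-vertex : ∀ {x f g j} → Incident G x f → Incident G x g → key f ≡ j → key g ≡ j → Reach (inj₁ j) f g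
  tree-vertex {x} {f} {g} xf xg key-f key-g with detached? f x | detached? g x
  ... | yes d | _     = tree-spoke d xf xg key-g
  ... | no _  | yes d = reach-sym (tree-spoke d xg xf key-f)
  ... | no ¬d | no ¬d′ = tree-star (xf , ¬d) (xg , ¬d′) key-f key-g

  -- Successive edges of a walk in `T i` share a vertex and have the same key, so the walk turns
  -- into one on its edges in `L G`.
  tree-walk : ∀ {i x y f} → Star (Adj G (T i)) x y → f ∈ E (T i) → Incident G x f →
              ∃[ g ] g ∈ E (T i) × Incident G y g × Reach (inj₁ (toℕ i)) f g
  tree-walk ε f∈ xf = _ , f∈ , xf , reach-refl
  tree-walk ((h , h∈ , j) ◅ w) f∈ xf =
    let g , g∈ , yg , r = tree-walk w h∈ (incidentʳ G j)
    in g , g∈ , yg , tree-vertex xf (incidentˡ G j) (key⁺ f∈) (key⁺ h∈) ⟫ r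

  -- A walk in `T i` from `v l` to `v m` starts and ends with edges of `T i` at these vertices; the
  -- hubs `e l` and `e m` are attached to them, whichever keys they have themselves.
  tree-connects : ∀ {i} → IsTree G (T i) → (∀ l → v l ∈ V (T i)) →
                  ∀ l m → Reach (inj₁ (toℕ i)) (e l) (e m)
  tree-connects {i} (conn , _) v∈ l m = go (conn (v l) (v m) (v∈ l) (v∈ m)) refl
    where
    spoke : ∀ l {g} → Incident G (v l) g → g ∈ E (T i) → Reach (inj₁ (toℕ i)) (e l) g
    spoke l v∈g g∈ = tree-spoke (l , refl , refl) (incidentˡ G (e-joins l)) v∈g (key⁺ g∈)

    go : ∀ {y} → Star (Adj G (T i)) (v l) y → y ≡ v m → Reach (inj₁ (toℕ i)) (e l) (e m)
    go ε eq with v-injective eq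
    ... | refl = reach-refl
    go ((h , h∈ , j) ◅ w) refl =
      let g , g∈ , vm∈g , r = tree-walk w h∈ (incidentʳ G j)
      in spoke l (incidentˡ G j) h∈ ⟫ r ⟫ reach-sym (spoke m vm∈g g∈)

  tree-owned : ∀ {i b f} → Owned (inj₁ (toℕ i)) b → Incident (L G) f b → f ∈ E (T i) ⊎ ∃[ l ] e l ≡ f
  tree-owned {b = b} eq f∈b = [ inj₁ ∘ key⁻ , inj₂ ]′ (owner-ends {b} eq f∈b)

-- Sets of a given size and distinct ends of three edges.

enumeration : ∀ {n k} (S : Subset n) → ∣ S ∣ ≡ k →
  Σ (Fin k → Fin n) λ f → Injective _≡_ _≡_ f × (∀ i → f i ∈ S) × (∀ {x} → x ∈ S → ∃[ i ] f i ≡ x)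
enumeration [] refl = (λ ()) , (λ { {()} }) , (λ ()) , λ ()
enumeration {suc n} (inside ∷ S) refl with enumeration S refl
... | f , f-injective , f∈ , f-onto = g , g-injective , g∈ , g-onto
  where
  g : Fin (suc ∣ S ∣) → Fin (suc n)
  g zero    = zero
  g (suc i) = suc (f i)

  g-injective : Injective _≡_ _≡_ g
  g-injective {zero}  {zero}  _  = refl
  g-injective {suc i} {suc j} eq = cong suc (f-injective (Fin.suc-injective eq))

  g∈ : ∀ i → g i ∈ inside ∷ S
  g∈ zero    = here
  g∈ (suc i) = there (f∈ i)

  g-onto : ∀ {x} → x ∈ inside ∷ S → ∃[ i ] g i ≡ x
  g-onto here       = zero , refl
  g-onto (there x∈) = let i , eq = f-onto x∈ in suc i , cong suc eq
enumeration (outside ∷ S) eq =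
  let f , f-injective , f∈ , f-onto = enumeration S eq
  in suc ∘ f , f-injective ∘ Fin.suc-injective , there ∘ f∈ ,
     λ { (there x∈) → let i , eq = f-onto x∈ in i , cong suc eq }

superset-of-size : ∀ {n k} (S : Subset n) → ∣ S ∣ ≤ k → k ≤ n → ∃[ S′ ] S ⊆ S′ × ∣ S′ ∣ ≡ k
superset-of-size [] _ z≤n = [] , id , refl
superset-of-size (inside ∷ S) (s≤s ∣S∣≤k) (s≤s k≤n) =
  let S′ , S⊆S′ , eq = superset-of-size S ∣S∣≤k k≤n
  in inside ∷ S′ , (λ { here → here ; (there x∈) → there (S⊆S′ x∈) }) , cong suc eq
superset-of-size {suc n} {k} (outside ∷ S) ∣S∣≤k k≤1+n with k ≤? n
... | yes k≤n = let S′ , S⊆S′ , eq = superset-of-size S ∣S∣≤k k≤n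
                in outside ∷ S′ , (λ { (there x∈) → there (S⊆S′ x∈) }) , eq
... | no k≰n = ⊤ , (λ _ → ∈⊤) , trans (∣⊤∣≡n (suc n)) (≤-antisym (≰⇒> k≰n) k≤1+n)

-- The `w l` may coincide, as in `triple x y y`; their image is enlarged to `k` elements. Thus trees
-- through three vertices also serve for two.
covering-set : ∀ {n k} → k ≤ n → (w : Fin k → Fin n) → ∃[ S ] ∣ S ∣ ≡ k × (∀ l → w l ∈ S)
covering-set k≤n w =
  let f , f-injective , f∈ , _ = enumeration image refl
      preimage = λ i → ∈-comprehension⁻ image? (f∈ i)
      S , image⊆S , ∣S∣≡k = superset-of-size image
        (injective⇒≤ {f = λ i → proj₁ (preimage i)} λ {i} {j} eq →
          f-injective (trans (sym (proj₂ (preimage i))) (trans (cong w eq) (proj₂ (preimage j)))))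
        k≤n
  in S , ∣S∣≡k , λ l → image⊆S (∈-comprehension⁺ image? (l , refl))
  where
  image? = λ x → any? λ l → w l Fin.≟ x
  image = comprehension image?

other-vertex : ∀ {n} → 2 ≤ n → (x : Fin n) → ∃[ y ] y ≢ x
other-vertex (s≤s (s≤s _)) zero    = suc zero , λ ()
other-vertex (s≤s (s≤s _)) (suc _) = zero , λ ()

triple : ∀ {A : Set} → A → A → A → Fin 3 → A
triple a b c zero             = a
triple a b c (suc zero)       = b
triple a b c (suc (suc zero)) = c

triple-injective : ∀ {A : Set} {a b c : A} → a ≢ b → a ≢ c → b ≢ c → Injective _≡_ _≡_ (triple a b c)
triple-injective a≢b a≢c b≢c {zero}           {zero}           _  = refl
triple-injective a≢b a≢c b≢c {zero}           {suc zero}       eq = contradiction eq a≢b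
triple-injective a≢b a≢c b≢c {zero}           {suc (suc zero)} eq = contradiction eq a≢c
triple-injective a≢b a≢c b≢c {suc zero}       {zero}           eq = contradiction (sym eq) a≢b
triple-injective a≢b a≢c b≢c {suc zero}       {suc zero}       _  = refl
triple-injective a≢b a≢c b≢c {suc zero}       {suc (suc zero)} eq = contradiction eq b≢c
triple-injective a≢b a≢c b≢c {suc (suc zero)} {zero}           eq = contradiction (sym eq) a≢c
triple-injective a≢b a≢c b≢c {suc (suc zero)} {suc zero}       eq = contradiction (sym eq) b≢c
triple-injective a≢b a≢c b≢c {suc (suc zero)} {suc (suc zero)} _  = refl

module _ {n : ℕ} (G : Graph n) where

  end-avoiding : ∀ f x → ∃[ y ] Incident G y f × y ≢ x
  end-avoiding f x with proj₁ (ends G f) Fin.≟ x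
  ... | yes refl = proj₂ (ends G f) , inj₂ refl , ≢-sym (joins-irrefl G (joins-ends G f))
  ... | no  ≢x   = proj₁ (ends G f) , inj₁ refl , ≢x

  -- Let `a` be an end of `e₀` and `b` another vertex, on `e₁`. Either `e₂` has an end other than
  -- these two, or it joins them; then `e₂` takes `a`, and `e₀` moves to its other end.
  distinct-ends : ∀ e → Injective _≡_ _≡_ e →
                  Σ (Fin 3 → Fin n) λ v → Injective _≡_ _≡_ v × (∀ l → Incident G (v l) (e l))
  distinct-ends e e-injective = choose (end-avoiding e₁ a)
    where
    e₀ = e zero
    e₁ = e (suc zero)
    e₂ = e (suc (suc zero))
    a = proj₁ (ends G e₀)

    Ends : Set
    Ends = Σ (Fin 3 → Fin n) λ v → Injective _≡_ _≡_ v × (∀ l → Incident G (v l) (e l))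

    pack : ∀ {x y z} → x ≢ y → x ≢ z → y ≢ z → Incident G x e₀ → Incident G y e₁ → Incident G z e₂ → Ends
    pack {x} {y} {z} x≢y x≢z y≢z p q r = triple x y z , triple-injective x≢y x≢z y≢z ,
      λ { zero → p ; (suc zero) → q ; (suc (suc zero)) → r }

    choose : (∃[ b ] Incident G b e₁ × b ≢ a) → Ends
    choose (b , b∈e₁ , b≢a) with incident? G a e₂ | incident? G b e₂
    ... | no a∉e₂ | _ =
      let c , c∈e₂ , c≢b = end-avoiding e₂ b
      in pack (≢-sym b≢a) (λ a≡c → a∉e₂ (subst (λ x → Incident G x e₂) (sym a≡c) c∈e₂)) (≢-sym c≢b) (inj₁ refl) b∈e₁ c∈e₂
    ... | yes _ | no b∉e₂ =
      let c , c∈e₂ , c≢a = end-avoiding e₂ a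
      in pack (≢-sym b≢a) (≢-sym c≢a) (λ b≡c → b∉e₂ (subst (λ x → Incident G x e₂) (sym b≡c) c∈e₂)) (inj₁ refl) b∈e₁ c∈e₂
    ... | yes a∈e₂ | yes b∈e₂ =
      pack w≢b (≢-sym (joins-irrefl G (joins-ends G e₀))) b≢a (inj₂ refl) b∈e₁ a∈e₂
      where
      -- e₂ joins a and b, so the other end of e₀ is not b.
      w≢b : proj₂ (ends G e₀) ≢ b
      w≢b w≡b with () ← e-injective {zero} {suc (suc zero)} (joins-unique G
        (subst (Joins G e₀ a) w≡b (joins-ends G e₀)) (incident-joins G a∈e₂ b∈e₂ (≢-sym b≢a)))

-- Three edges have distinct chosen ends. For item (3) this turns the assumption on the order of
-- `L (L G)` into the one on the order of `L G`.
size≥3⇒order≥3 : ∀ {n} (G : Graph n) → 3 ≤ size G → 3 ≤ n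
size≥3⇒order≥3 G 3≤ = injective⇒≤ (proj₁ (proj₂
  (distinct-ends G (λ l → inject≤ l 3≤) (λ {l} {m} → inject≤-injective 3≤ 3≤ l m))))

-- Degrees and connectivity in terms of `λ₃`.

module Trees {n : ℕ} (G : Graph n) (3≤n : 3 ≤ n) where
  open Subgraph

  λ₃≤λ-of : ∀ {S} (∣S∣≡3 : ∣ S ∣ ≡ 3) → λ₃ G 3≤n ≤ λ-of G S (3⇒2≤ ∣S∣≡3)
  λ₃≤λ-of {S} ∣S∣≡3 = proj₂ (proj₂ (minimum₃ 3≤n (λ-of G))) _ (S , ∣S∣≡3 , refl)

  TreePacking : ℕ → (Fin 3 → Fin n) → Set
  TreePacking k w = Σ (Fin k → Subgraph G) λ T →
    (∀ i → IsTree G (T i) × (∀ l → w l ∈ V (T i))) × (∀ i j → i ≢ j → EdgeDisjoint G (T i) (T j))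

  trees-through : ∀ w → ∃[ k ] λ₃ G 3≤n ≤ k × TreePacking k w
  trees-through w =
    let S , ∣S∣≡3 , w∈S = covering-set 3≤n w
        k , (T , T-connecting , T-disjoint) , _ = λ-exists G S (3⇒2≤ ∣S∣≡3)
    in k , λ₃≤λ-of ∣S∣≡3 , T ,
       (λ i → proj₁ (T-connecting i) , λ l → proj₂ (T-connecting i) (w∈S l)) , T-disjoint

  -- Each of the edge-disjoint trees through `x` and a second vertex has an edge at `x`, and these
  -- edges differ.
  incident-edges : ∀ x → ∃[ k ] λ₃ G 3≤n ≤ k ×
    Σ (Fin k → Edge G) λ f → Injective _≡_ _≡_ f × (∀ i → Incident G x (f i))
  incident-edges x =
    let y , y≢x = other-vertex (≤-trans (s≤s (s≤s z≤n)) 3≤n) x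
        k , λ₃≤k , T , T-tree , T-disjoint = trees-through (triple x y y)
        edge = λ i → [ (λ y≡x → contradiction y≡x y≢x) , id ]′ (star-end-incident G
                 (proj₁ (proj₁ (T-tree i)) y x (proj₂ (T-tree i) (suc zero)) (proj₂ (T-tree i) zero)))
    in k , λ₃≤k , (λ i → proj₁ (edge i)) ,
       (λ {i} {j} eq → tree-unique T T-disjoint (proj₁ (proj₂ (edge i)))
          (subst (_∈ E (T j)) (sym eq) (proj₁ (proj₂ (edge j))))) ,
       λ i → proj₂ (proj₂ (edge i))

  -- Among at least four edge-disjoint trees through `x` and `y`, one contains none of the three
  -- edges.
  walk-avoiding : 4 ≤ λ₃ G 3≤n → (e : Fin 3 → Edge G) → ∀ x y → Star (Along G λ h → ∀ l → e l ≢ h) x y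
  walk-avoiding 4≤λ₃ e x y =
    let k , λ₃≤k , T , T-tree , T-disjoint = trees-through (triple x y y)
        meets? = λ i → any? λ l → e l ∈? E (T i)
    in [ (λ (i , avoids) → along-mono G (λ { h∈ l refl → avoids (l , h∈) })
            (proj₁ (proj₁ (T-tree i)) x y (proj₂ (T-tree i) zero) (proj₂ (T-tree i) (suc zero))))
       , (λ all-meet → contradiction
            (≤-trans 4≤λ₃ (≤-trans λ₃≤k (injective⇒≤ {f = λ i → proj₁ (all-meet i)} λ {i} {j} eq →
              tree-unique T T-disjoint (proj₂ (all-meet i))
                (subst (λ l → e l ∈ E (T j)) (sym eq) (proj₂ (all-meet j)))))) 1+n≰n)
       ]′ (search meets?)
    where
    search : ∀ {k} {P : Fin k → Set} → (∀ i → Dec (P i)) → (∃[ i ] ¬ P i) ⊎ (∀ i → P i)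
    search P? with any? (¬? ∘ P?)
    ... | yes i = inj₁ i
    ... | no ¬i = inj₂ λ i → decidable-stable (P? i) λ ¬p → ¬i (i , ¬p)

-- Number of layers and the factor 3/2.

layer-count : ∀ k → ∃[ m ] k ≤ m + m + 4 × (∀ {c} → c < m → suc (suc (suc c + suc c)) < k)
-- The witness is `⌈k / 2⌉ - 2`, cut off at 0. Layer `c` has colour `c + 1`, which asks for
-- `2 c + 3 < degree x`; one more is required of `k`, as `degree x` may be as small as `k - 1`.
layer-count 0 = 0 , z≤n , λ ()
layer-count 1 = 0 , s≤s z≤n , λ ()
layer-count 2 = 0 , s≤s (s≤s z≤n) , λ ()
layer-count (suc (suc (suc k))) with halve k
... | even q = q , ≤-trans (n≤1+n _) (≤-reflexive (+-comm 4 (q + q))) , bound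
  where
  bound : ∀ {c} → c < q → suc (suc (suc c + suc c)) < suc (suc (suc (q + q)))
  bound c<q = s≤s (s≤s (s≤s (+-mono-≤ c<q c<q)))
... | odd q = q , ≤-reflexive (+-comm 4 (q + q)) , bound
  where
  bound : ∀ {c} → c < q → suc (suc (suc c + suc c)) < suc (suc (suc (suc (q + q))))
  bound c<q = s≤s (s≤s (s≤s (≤-trans (+-mono-≤ c<q c<q) (n≤1+n _))))

-- In the unnormalised rationals, clearing denominators is a computation and leaves `3 b - 4 ≤ 2 a`
-- over the integers.
three-halves : ∀ {a b} → 3 ℕ.* b ≤ 2 ℕ.* a + 4 →
               (+ a / 1) ℚ.≥ (+ 3 / 2) * (+ b / 1) - (+ 2 / 1)
three-halves {a} {b} h = toℚᵘ-cancel-≤ (begin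
  toℚᵘ ((+ 3 / 2) * (+ b / 1) - (+ 2 / 1))
    ≃⟨ toℚᵘ-homo-+ ((+ 3 / 2) * (+ b / 1)) (ℚ.- (+ 2 / 1)) ⟩
  toℚᵘ ((+ 3 / 2) * (+ b / 1)) ℚᵘ.+ mkℚᵘ (ℤ.- + 2) 0
    ≃⟨ ℚᵘ.+-congˡ _ (toℚᵘ-homo-* (+ 3 / 2) (+ b / 1)) ⟩
  mkℚᵘ (+ 3) 1 ℚᵘ.* toℚᵘ (+ b / 1) ℚᵘ.+ mkℚᵘ (ℤ.- + 2) 0
    ≃⟨ ℚᵘ.+-congˡ _ (ℚᵘ.*-congˡ {mkℚᵘ (+ 3) 1} (toℚᵘ-fromℚᵘ (mkℚᵘ (+ b) 0))) ⟩
  mkℚᵘ (+ 3) 1 ℚᵘ.* mkℚᵘ (+ b) 0 ℚᵘ.+ mkℚᵘ (ℤ.- + 2) 0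
    ≤⟨ *≤* (subst₂ ℤ._≤_ (sym lhs) (sym rhs)
         (ℤ.+-monoˡ-≤ (ℤ.- + 4) (ℤ.+≤+ (subst (3 ℕ.* b ≤_) (cong (_+ 4) (*-comm 2 a)) h)))) ⟩
  mkℚᵘ (+ a) 0
    ≃⟨ ℚᵘ.≃-sym (toℚᵘ-fromℚᵘ (mkℚᵘ (+ a) 0)) ⟩
  toℚᵘ (+ a / 1) ∎)
  where
  open ℚᵘ.≤-Reasoning

  lhs : ((+ 3 ℤ.* + b) ℤ.* + 1 ℤ.+ (ℤ.- + 2) ℤ.* + 2) ℤ.* + 1 ≡ + (3 ℕ.* b) ℤ.+ (ℤ.- + 4)
  lhs = trans (ℤ.*-identityʳ _) (cong (ℤ._+ (ℤ.- + 4)) (trans (ℤ.*-identityʳ _) (sym (ℤ.pos-* 3 b))))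

  rhs : + a ℤ.* + 2 ≡ + (a ℕ.* 2 + 4) ℤ.+ (ℤ.- + 4)
  rhs = trans (sym (ℤ.pos-* a 2)) (sym (trans (cong (ℤ._+ (ℤ.- + 4)) (ℤ.pos-+ (a ℕ.* 2) 4)) (trans (ℤ.+-assoc (+ (a ℕ.* 2)) (+ 4) (ℤ.- + 4)) (ℤ.+-identityʳ _))))

-- Packings of trees in the line graph.

module Packings {n k : ℕ} (G : Graph n)
  (e : Fin 3 → Edge G) (e-injective : Injective _≡_ _≡_ e)
  (v u : Fin 3 → Fin n) (v-injective : Injective _≡_ _≡_ v)
  (e-joins : ∀ l → Joins G (e l) (v l) (u l))
  (T : Fin k → Subgraph G) (T-disjoint : ∀ i j → i ≢ j → EdgeDisjoint G (T i) (T j))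
  (T-tree : ∀ i → IsTree G (T i) × (∀ l → v l ∈ Subgraph.V (T i)))
  {S : Subset (size G)} (e∈S : ∀ l → e l ∈ S) (e-onto : ∀ {s} → s ∈ S → ∃[ l ] e l ≡ s) where
  open Subgraph
  open Allocation G e e-injective v u v-injective e-joins T T-disjoint

  owned? : ∀ o b → Dec (Owned o b)
  owned? o b = ⊎-≡-dec ℕ._≟_ ℕ._≟_ (owner b) o

  connects : ∀ {o} → (∀ l m → Reach o (e l) (e m)) →
             ∀ {s} → s ∈ S → Star (Along (L G) (Owned o)) (e zero) s
  connects reach s∈ with e-onto s∈
  ... | l , refl = reach⇒star (reach zero l)

  trees-reach : ∀ i l m → Reach (inj₁ (toℕ i)) (e l) (e m)
  trees-reach i = tree-connects (proj₁ (T-tree i)) (proj₂ (T-tree i))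

  -- Apart from the `e l`, the vertices of tree `i` in `L G` are edges of `T i`, and no two of the
  -- `T i` share an edge.
  tree-packing : Packing (L G) S (InternallyDisjoint (L G) S) k
  tree-packing = internally-disjoint-packing (L G) {P = λ i → Owned (inj₁ (toℕ i))}
    (λ i → owned? (inj₁ (toℕ i)))
    (λ p q → toℕ-injective (inj₁-injective (trans (sym p) q)))
    (λ i → connects (trees-reach i))
    (e∈S zero)
    {W = λ i f → f ∈ E (T i) ⊎ ∃[ l ] e l ≡ f}
    (λ {i} {b} → tree-owned {i} {b})
    W-disjoint
    where
    W-disjoint : ∀ {i j f} → i ≢ j → f ∈ E (T i) ⊎ (∃[ l ] e l ≡ f) → f ∈ E (T j) ⊎ (∃[ l ] e l ≡ f) → f ∈ S
    W-disjoint i≢j (inj₂ (l , refl)) _                 = e∈S l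
    W-disjoint i≢j (inj₁ _)          (inj₂ (l , refl)) = e∈S l
    W-disjoint i≢j (inj₁ f∈i)        (inj₁ f∈j)        = contradiction (tree-unique T T-disjoint f∈i f∈j) i≢j

  module _ {d : ℕ}
           (incident-edges : ∀ x → ∃[ p ] d ≤ p ×
             Σ (Fin p → Edge G) λ f → Injective _≡_ _≡_ f × (∀ i → Incident G x (f i)))
           (walk-avoiding : 4 ≤ d → ∀ x y → Star (Along G λ h → ∀ l → e l ≢ h) x y) where

    layers-reach : ∀ {c} → suc (suc (suc c + suc c)) < d → ∀ l m → Reach (inj₂ (suc c)) (e l) (e m)
    layers-reach {c} c< = layer-connects degree-large (walk-avoiding 4≤d)
      where
      degree-large : ∀ x → suc (suc c + suc c) < degree x
      degree-large x =
        let _ , d≤p , f , f-injective , f∋x = incident-edges x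
        -- The successor taken off here is the edge that may be detached at `x`.
        in s≤s⁻¹ (≤-trans c< (≤-trans d≤p (degree-bound f f-injective f∋x)))

      -- The presence of a layer already forces `d` to exceed 4.
      4≤d : 4 ≤ d
      4≤d = ≤-trans (s≤s (s≤s (s≤s (≤-trans (s≤s z≤n) (≤-reflexive (sym (+-suc c c))))))) (<⇒≤ c<)

    module _ {m : ℕ} (m-layers : ∀ {c} → c < m → suc (suc (suc c + suc c)) < d) where

      -- Layers start at colour 1 because colour 0 is spent on the trees.
      code : Fin k ⊎ Fin m → ℕ ⊎ ℕ
      code (inj₁ i) = inj₁ (toℕ i)
      code (inj₂ c) = inj₂ (suc (toℕ c))

      code-injective : Injective _≡_ _≡_ code
      code-injective {inj₁ i} {inj₁ j} eq = cong inj₁ (toℕ-injective (inj₁-injective eq))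
      code-injective {inj₂ c} {inj₂ d} eq = cong inj₂ (toℕ-injective (suc-injective (inj₂-injective eq)))

      splitAt-injective : Injective _≡_ _≡_ (splitAt k {m})
      splitAt-injective {i} {j} eq =
        trans (sym (join-splitAt k m i)) (trans (cong (join k m) eq) (join-splitAt k m j))

      code-reach : ∀ i l l′ → Reach (code i) (e l) (e l′)
      code-reach (inj₁ i) = trees-reach i
      code-reach (inj₂ c) = layers-reach (m-layers (toℕ<n c))

      layered-packing : Packing (L G) S (EdgeDisjoint (L G)) (k + m)
      layered-packing = edge-disjoint-packing (L G) {P = λ i → Owned (code (splitAt k i))}
        (λ i → owned? (code (splitAt k i)))
        (λ p q → splitAt-injective (code-injective (trans (sym p) q)))
        (λ i → connects (code-reach (splitAt k i)))

-- Inequalities between `κ₃` and `λ₃` of a graph and its line graph.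

module _ {n : ℕ} (G : Graph n) (3≤n : 3 ≤ n) where
  open Trees G 3≤n

  -- Both packings start from the same `k` edge-disjoint trees through distinct ends of the edges in
  -- `S`.
  line-packings : ∀ {S : Subset (size G)} → ∣ S ∣ ≡ 3 → ∃[ k ] λ₃ G 3≤n ≤ k
    × Packing (L G) S (InternallyDisjoint (L G) S) k
    × (∀ {m} → (∀ {c} → c < m → suc (suc (suc c + suc c)) < λ₃ G 3≤n) →
       Packing (L G) S (EdgeDisjoint (L G)) (k + m))
  line-packings ∣S∣≡3 =
    let e , e-injective , e∈S , e-onto = enumeration _ ∣S∣≡3
        v , v-injective , v∈e = distinct-ends G e e-injective
        k , λ₃≤k , T , T-tree , T-disjoint = trees-through v
        opposite = λ l → other-end G (v∈e l)
    in k , λ₃≤k ,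
       tree-packing G e e-injective v (λ l → proj₁ (opposite l)) v-injective (λ l → proj₂ (opposite l))
         T T-disjoint T-tree e∈S e-onto ,
       layered-packing G e e-injective v (λ l → proj₁ (opposite l)) v-injective (λ l → proj₂ (opposite l))
         T T-disjoint T-tree e∈S e-onto incident-edges (λ 4≤λ₃ → walk-avoiding 4≤λ₃ e)
    where open Packings

  -- Internally disjoint trees are edge-disjoint, so it is enough to compare at a set `S` that
  -- attains `λ₃`.
  κ₃≤λ₃ : κ₃ G 3≤n ≤ λ₃ G 3≤n
  κ₃≤λ₃ =
    let (S , ∣S∣≡3 , λ-of≡λ₃) , _ = proj₂ (minimum₃ 3≤n (λ-of G))
        _ , (T , T-connecting , T-disjoint) , _ = κ-exists G S (3⇒2≤ ∣S∣≡3)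
    in begin
      κ₃ G 3≤n                ≤⟨ proj₂ (proj₂ (minimum₃ 3≤n (κ-of G))) _ (S , ∣S∣≡3 , refl) ⟩
      κ-of G S (3⇒2≤ ∣S∣≡3)   ≤⟨ proj₂ (proj₂ (λ-exists G S (3⇒2≤ ∣S∣≡3))) _
                                   (T , T-connecting , λ i j i≢j → proj₁ (T-disjoint i j i≢j)) ⟩
      λ-of G S (3⇒2≤ ∣S∣≡3)   ≡⟨ λ-of≡λ₃ ⟩
      λ₃ G 3≤n                ∎
    where open ≤-Reasoning

  λ₃≤κ₃-L : (3≤m : 3 ≤ size G) → λ₃ G 3≤n ≤ κ₃ (L G) 3≤m
  λ₃≤κ₃-L 3≤m =
    let (S , ∣S∣≡3 , κ-of≡κ₃) , _ = proj₂ (minimum₃ 3≤m (κ-of (L G)))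
        k , λ₃≤k , trees , _ = line-packings ∣S∣≡3
    in begin
      λ₃ G 3≤n                  ≤⟨ λ₃≤k ⟩
      k                         ≤⟨ proj₂ (proj₂ (κ-exists (L G) S (3⇒2≤ ∣S∣≡3))) k trees ⟩
      κ-of (L G) S (3⇒2≤ ∣S∣≡3) ≡⟨ κ-of≡κ₃ ⟩
      κ₃ (L G) 3≤m              ∎
    where open ≤-Reasoning

  -- There are `k + m` edge-disjoint trees, where `k` is at least `λ₃ G` and `2 m + 4` is at least
  -- `λ₃ G`. Doubling avoids fractions.
  3λ₃≤2λ₃-L+4 : (3≤m : 3 ≤ size G) → 3 ℕ.* λ₃ G 3≤n ≤ 2 ℕ.* λ₃ (L G) 3≤m + 4
  3λ₃≤2λ₃-L+4 3≤m =
    let (S , ∣S∣≡3 , λ-of≡λ₃) , _ = proj₂ (minimum₃ 3≤m (λ-of (L G)))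
        k , λ₃≤k , _ , layered = line-packings ∣S∣≡3
        m , λ₃≤2m+4 , m-layers = layer-count (λ₃ G 3≤n)
    in begin
      3 ℕ.* λ₃ G 3≤n                ≡⟨ +-comm (λ₃ G 3≤n) (2 ℕ.* λ₃ G 3≤n) ⟩
      2 ℕ.* λ₃ G 3≤n + λ₃ G 3≤n     ≤⟨ +-mono-≤ (*-monoʳ-≤ 2 λ₃≤k) λ₃≤2m+4 ⟩
      2 ℕ.* k + (m + m + 4)         ≡⟨ sym (+-assoc (2 ℕ.* k) (m + m) 4) ⟩
      2 ℕ.* k + (m + m) + 4         ≡⟨ cong (λ t → 2 ℕ.* k + (m + t) + 4) (sym (+-identityʳ m)) ⟩
      2 ℕ.* k + 2 ℕ.* m + 4           ≡⟨ cong (_+ 4) (sym (*-distribˡ-+ 2 k m)) ⟩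
      2 ℕ.* (k + m) + 4             ≤⟨ +-monoˡ-≤ 4 (*-monoʳ-≤ 2
        (≤-trans (proj₂ (proj₂ (λ-exists (L G) S (3⇒2≤ ∣S∣≡3))) (k + m) (layered m-layers))
                 (≤-reflexive λ-of≡λ₃))) ⟩
      2 ℕ.* λ₃ (L G) 3≤m + 4        ∎
    where open ≤-Reasoning

proposition5 : ∀ {n : ℕ} (G : Graph n) → Connected G →
    ((nG : 3 ≤ n) (nL : 3 ≤ size G) → λ₃ G nG ≤ κ₃ (L G) nL)
    × ((nG : 3 ≤ n) (nL : 3 ≤ size G) →
    (+ λ₃ (L G) nL / 1) ℚ.≥ (+ 3 / 2) * (+ λ₃ G nG / 1) - (+ 2 / 1))
    × ((nG : 3 ≤ n) (nLL : 3 ≤ size (L G)) →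
    (+ κ₃ (L (L G)) nLL / 1) ℚ.≥ (+ 3 / 2) * (+ κ₃ G nG / 1) - (+ 2 / 1))
proposition5 G _ =
  λ₃≤κ₃-L G ,
  (λ nG nL → three-halves {λ₃ (L G) nL} {λ₃ G nG} (3λ₃≤2λ₃-L+4 G nG nL)) ,
  λ nG nLL → let nL = size≥3⇒order≥3 (L G) nLL in
    three-halves {κ₃ (L (L G)) nLL} {κ₃ G nG}
      (≤-trans (*-monoʳ-≤ 3 (κ₃≤λ₃ G nG)) (≤-trans (3λ₃≤2λ₃-L+4 G nG nL)
        (+-monoˡ-≤ 4 (*-monoʳ-≤ 2 (λ₃≤κ₃-L (L G) nL nLL)))))
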